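{- Let $p \geq q$ and $n\ge 1$ be positive integers and let $B$ be a $p\times q$ matrix with nonnegative real entries. Let $C$ be the $(nq+p)\times(nq+p)$ block matrix whose first block row is $[\,0_p\ B\ B\ \cdots\ B\,]$ ($n$ copies of $B$), whose first block column is $[\,0_p\ B^T\ \cdots\ B^T\,]^T$ ($n$ copies of $B^T$), and whose remaining blocks are all zero; and let $D$ be the $(np+q)\times(np+q)$ block matrix whose first block row is $[\,0_q\ B^T\ B^T\ \cdots\ B^T\,]$ ($n$ copies of $B^T$), whose first block column is $[\,0_q\ B\ \cdots\ B\,]^T$ ($n$ copies of $B$), and whose remaining blocks are all zero. Then the normalized Laplacians $L(C\oplus 0_{(n-1)(p-q)})$ and $L(D)$ are cospectral.
   Context: For matrices $X,Y$, $X\oplus Y=\begin{bmatrix} X&0\\0&Y\end{bmatrix}$; $0_m$ is the $m\times m$ zero matrix. For a nonnegative real symmetric matrix $M$ with positive row sums, its normalized Laplacian is $L(M)=I-\Delta^{ -1/2}M\Delta^{ -1/2}$, where $\Delta$ is the diagonal matrix of row sums of $M$. If $M$ has zero row sums, write (after a simultaneous permutation of rows and columns) $M=M_1\oplus 0_k$ where $M_1$ has positive row sums; then $L(M)=L(M_1)\oplus I_k$ (equivalently, $L(M)=I-(\Delta^{\dagger})^{1/2}M(\Delta^{\dagger})^{1/2}$ with $\Delta^\dagger$ the Moore–Penrose inverse of $\Delta$). Two square matrices are cospectral if they have the same eigenvalues with the same multiplicities. -}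

module Defs where

open import Algebra.Bundles using (CommutativeRing)
open import Algebra.Bundles.Raw using (RawRing)
import Algebra.Definitions.RawSemiring as RawSemiringDefs
import Algebra.Properties.Group as GroupProperties
import Algebra.Properties.Ring as RingProperties
import Algebra.Solver.Ring.NaturalCoefficients.Default as SemiringSolver
open import Data.Fin.Base using (Fin; zero; suc; splitAt; remainder; punchIn; toℕ)
import Data.Fin.Properties as Fin
open import Data.List.Base using (List; []; _∷_; map)
open import Data.Nat.Base as ℕ using (ℕ; zero; suc)
open import Data.Product.Base using (Σ; ∃; _×_; _,_; proj₁; proj₂)
open import Data.Sum.Base using (_⊎_; inj₁; inj₂; [_,_]′)
open import Data.Vec.Functional using (Vector)
open import Function.Bundles using (_⇔_)
open import Level using (Level; _⊔_) renaming (suc to lsuc)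
import Relation.Binary.Reasoning.Setoid as SetoidReasoning
open import Relation.Binary.Structures using (IsDecTotalOrder)
open import Relation.Nullary using (¬_; yes; no; contradiction)
open import Relation.Unary using (Pred)

-- The real numbers, given axiomatically as a Dedekind-complete ordered
-- field; classically such a field is unique up to isomorphism.  The order
-- and equality are decidable because the mathematics is classical: the
-- definition of L(M) distinguishes zero from positive row sums.

record CompleteOrderedField c ℓ₁ ℓ₂ : Set (lsuc (c ⊔ ℓ₁ ⊔ ℓ₂)) where
  infix 4 _≤_
  field
    commutativeRing : CommutativeRing c ℓ₁

  open CommutativeRing commutativeRing public

  field
    _≤_             : Carrier → Carrier → Set ℓ₂
    isDecTotalOrder : IsDecTotalOrder _≈_ _≤_
    +-monoʳ-≤       : ∀ x {y z} → y ≤ z → x + y ≤ x + z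
    *-nonNeg        : ∀ {x y} → 0# ≤ x → 0# ≤ y → 0# ≤ x * y
    0≉1             : ¬ 0# ≈ 1#
    inverse         : ∀ x → ¬ x ≈ 0# → ∃ λ y → x * y ≈ 1#

  UpperBound : Pred Carrier ℓ₂ → Carrier → Set (c ⊔ ℓ₂)
  UpperBound P u = ∀ x → P x → x ≤ u

  field
    supremum : (P : Pred Carrier ℓ₂) → ∃ P → ∃ (UpperBound P) →
               ∃ λ s → UpperBound P s × (∀ u → UpperBound P u → s ≤ u)

  open IsDecTotalOrder isDecTotalOrder public
    using (_≟_; _≤?_; total; antisym; ≤-respˡ-≈; ≤-respʳ-≈)
    renaming (refl to ≤-refl; trans to ≤-trans; reflexive to ≤-reflexive)

module SquareRoot {c ℓ₁ ℓ₂} (ℝ : CompleteOrderedField c ℓ₁ ℓ₂) where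
  open CompleteOrderedField ℝ
  open SetoidReasoning setoid
  open SemiringSolver commutativeSemiring
    using (solve; _:=_; _:+_; _:*_; con)

  ≤-resp : ∀ {x x′ y y′} → x ≈ x′ → y ≈ y′ → x ≤ y → x′ ≤ y′
  ≤-resp p q x≤y = ≤-respˡ-≈ p (≤-respʳ-≈ q x≤y)

  +-nonNeg : ∀ {x y} → 0# ≤ x → 0# ≤ y → 0# ≤ x + y
  +-nonNeg {x} 0≤x 0≤y = ≤-trans 0≤x (≤-respˡ-≈ (+-identityʳ x) (+-monoʳ-≤ x 0≤y))

  x≤x+y : ∀ x {y} → 0# ≤ y → x ≤ x + y
  x≤x+y x 0≤y = ≤-respˡ-≈ (+-identityʳ x) (+-monoʳ-≤ x 0≤y)

  difference : ∀ {x y} → x ≤ y → ∃ λ d → 0# ≤ d × x + d ≈ y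
  difference {x} {y} x≤y = - x + y , ≤-respˡ-≈ (-‿inverseˡ x) (+-monoʳ-≤ (- x) x≤y) , eq
    where
    eq : x + (- x + y) ≈ y
    eq = begin
      x + (- x + y)  ≈⟨ sym (+-assoc x (- x) y) ⟩
      x + - x + y    ≈⟨ +-congʳ (-‿inverseʳ x) ⟩
      0# + y         ≈⟨ +-identityˡ y ⟩
      y              ∎

  +-cancel : ∀ x {y z} → x + y ≈ x + z → y ≈ z
  +-cancel x {y} {z} = GroupProperties.∙-cancelˡ +-group x y z

  +-cancel-≤ : ∀ x {y} → x + y ≤ x → y ≤ 0#
  +-cancel-≤ x {y} p = ≤-resp eq (-‿inverseˡ x) (+-monoʳ-≤ (- x) p)
    where
    eq : - x + (x + y) ≈ y
    eq = begin
      - x + (x + y)  ≈⟨ sym (+-assoc (- x) x y) ⟩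
      - x + x + y    ≈⟨ +-congʳ (-‿inverseˡ x) ⟩
      0# + y         ≈⟨ +-identityˡ y ⟩
      y              ∎

  neg-nonNeg : ∀ {x} → x ≤ 0# → 0# ≤ - x
  neg-nonNeg {x} x≤0 =
    ≤-resp (-‿inverseˡ x) (+-identityʳ (- x)) (+-monoʳ-≤ (- x) x≤0)

  0≤1 : 0# ≤ 1#
  0≤1 with total 0# 1#
  ... | inj₁ p = p
  ... | inj₂ p = ≤-respʳ-≈ eq (*-nonNeg (neg-nonNeg p) (neg-nonNeg p))
    where
    open RingProperties ring using (-1*x≈-x; -‿involutive)
    eq : - 1# * - 1# ≈ 1#
    eq = trans (-1*x≈-x (- 1#)) (-‿involutive 1#)

  1≰0 : ¬ 1# ≤ 0#
  1≰0 p = 0≉1 (antisym 0≤1 p)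

  inverse-nonNeg : ∀ {k i} → 0# ≤ k → k * i ≈ 1# → 0# ≤ i
  inverse-nonNeg {k} {i} 0≤k ki≈1 with total 0# i
  ... | inj₁ p = p
  ... | inj₂ p = contradiction (≤-resp lhs rhs (+-monoʳ-≤ 1# 0≤-1)) 1≰0
    where
    open RingProperties ring using (-‿distribʳ-*)
    0≤-1 : 0# ≤ - 1#
    0≤-1 = ≤-respʳ-≈ (trans (sym (-‿distribʳ-* k i)) (-‿cong ki≈1))
                     (*-nonNeg 0≤k (neg-nonNeg p))
    lhs : 1# + 0# ≈ 1#
    lhs = +-identityʳ 1#
    rhs : 1# + - 1# ≈ 0#
    rhs = -‿inverseʳ 1#

  *-cancel-0 : ∀ {x y i} → y * i ≈ 1# → x * y ≈ 0# → x ≈ 0#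
  *-cancel-0 {x} {y} {i} yi≈1 xy≈0 = begin
    x            ≈⟨ sym (*-identityʳ x) ⟩
    x * 1#       ≈⟨ *-congˡ (sym yi≈1) ⟩
    x * (y * i)  ≈⟨ sym (*-assoc x y i) ⟩
    x * y * i    ≈⟨ *-congʳ xy≈0 ⟩
    0# * i       ≈⟨ zeroˡ i ⟩
    0#           ∎

  square-mono : ∀ {x y} → 0# ≤ x → x ≤ y → x * x ≤ y * y
  square-mono {x} {y} 0≤x x≤y with difference x≤y
  ... | d , 0≤d , x+d≈y = ≤-respʳ-≈ eq
    (x≤x+y (x * x) (*-nonNeg (+-nonNeg (+-nonNeg 0≤x 0≤x) 0≤d) 0≤d))
    where
    eq : x * x + (x + x + d) * d ≈ y * y
    eq = begin
      x * x + (x + x + d) * d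
        ≈⟨ solve 2 (λ x d → x :* x :+ (x :+ x :+ d) :* d := (x :+ d) :* (x :+ d)) refl x d ⟩
      (x + d) * (x + d)
        ≈⟨ *-cong x+d≈y x+d≈y ⟩
      y * y ∎

  ≰⇒≥ : ∀ {x y} → ¬ x ≤ y → y ≤ x
  ≰⇒≥ {x} {y} x≰y with total x y
  ... | inj₁ p = contradiction p x≰y
  ... | inj₂ p = p

  private
    module _ (a : Carrier) (0≤a : 0# ≤ a) where

      0*0≤a : 0# * 0# ≤ a
      0*0≤a = ≤-respˡ-≈ (sym (zeroˡ 0#)) 0≤a

      bound : UpperBound (λ x → x * x ≤ a) (1# + a)
      bound x x²≤a with x ≤? 1# + a
      ... | yes p = p
      ... | no  p = contradiction
        (+-cancel-≤ a (≤-respˡ-≈ (+-comm 1# a)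
          (≤-trans (≤-respʳ-≈ eq (x≤x+y (1# + a) (+-nonNeg 0≤a (*-nonNeg 0≤a 0≤a))))
            (≤-trans (square-mono (+-nonNeg 0≤1 0≤a) (≰⇒≥ p)) x²≤a))))
        1≰0
        where
        eq : 1# + a + (a + a * a) ≈ (1# + a) * (1# + a)
        eq = solve 1 (λ a → con 1 :+ a :+ (a :+ a :* a) := (con 1 :+ a) :* (con 1 :+ a)) refl a

      sup = supremum (λ x → x * x ≤ a) (0# , 0*0≤a) (1# + a , bound)

      y : Carrier
      y = proj₁ sup

      isBound : UpperBound (λ x → x * x ≤ a) y
      isBound = proj₁ (proj₂ sup)

      isLeast : ∀ u → UpperBound (λ x → x * x ≤ a) u → y ≤ u
      isLeast = proj₂ (proj₂ sup)

      0≤y : 0# ≤ y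
      0≤y = isBound 0# 0*0≤a

      a≤y² : a ≤ y * y
      a≤y² with a ≤? y * y
      ... | yes p = p
      ... | no a≰y² with difference (≰⇒≥ a≰y²)
      ...   | d , 0≤d , y²+d≈a = contradiction (antisym ε≤0 0≤ε) ε≉0
        where
        k = y + y + 1# + d
        0≤2y+1 : 0# ≤ y + y + 1#
        0≤2y+1 = +-nonNeg (+-nonNeg 0≤y 0≤y) 0≤1
        k≉0 : ¬ k ≈ 0#
        k≉0 k≈0 = 1≰0 (≤-respʳ-≈ (trans eq k≈0) (x≤x+y 1# (+-nonNeg (+-nonNeg 0≤y 0≤y) 0≤d)))
          where
          eq : 1# + (y + y + d) ≈ k
          eq = solve 2 (λ y d → con 1 :+ (y :+ y :+ d) := y :+ y :+ con 1 :+ d) refl y d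
        i = proj₁ (inverse k k≉0)
        ki≈1 : k * i ≈ 1#
        ki≈1 = proj₂ (inverse k k≉0)
        0≤i : 0# ≤ i
        0≤i = inverse-nonNeg (+-nonNeg 0≤2y+1 0≤d) ki≈1
        ε = d * i
        f = (y + y + 1#) * i
        0≤ε : 0# ≤ ε
        0≤ε = *-nonNeg 0≤d 0≤i
        d≉0 : ¬ d ≈ 0#
        d≉0 d≈0 = a≰y² (≤-reflexive (trans (sym y²+d≈a) (trans (+-congˡ d≈0) (+-identityʳ _))))
        ε≉0 : ¬ ε ≈ 0#
        ε≉0 ε≈0 = d≉0 (*-cancel-0 (trans (*-comm i k) ki≈1) ε≈0)
        eq : (y + ε) * (y + ε) + ε * (d + f) ≈ a
        eq = begin
          (y + ε) * (y + ε) + ε * (d + f)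
            ≈⟨ solve 3 (λ y d i →
                 (y :+ d :* i) :* (y :+ d :* i) :+ d :* i :* (d :+ (y :+ y :+ con 1) :* i)
                   := y :* y :+ (d :* i :* (y :+ y :+ d)
                        :+ d :* i :* ((y :+ y :+ con 1 :+ d) :* i)))
                 refl y d i ⟩
          y * y + (ε * (y + y + d) + ε * (k * i))
            ≈⟨ +-congˡ (+-congˡ (*-congˡ ki≈1)) ⟩
          y * y + (ε * (y + y + d) + ε * 1#)
            ≈⟨ solve 3 (λ y d i →
                 y :* y :+ (d :* i :* (y :+ y :+ d) :+ d :* i :* con 1)
                   := y :* y :+ d :* ((y :+ y :+ con 1 :+ d) :* i))
                 refl y d i ⟩
          y * y + d * (k * i)
            ≈⟨ +-congˡ (trans (*-congˡ ki≈1) (*-identityʳ d)) ⟩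
          y * y + d
            ≈⟨ y²+d≈a ⟩
          a ∎
        ε≤0 : ε ≤ 0#
        ε≤0 = +-cancel-≤ y (isBound (y + ε) (≤-respʳ-≈ eq
                (x≤x+y _ (*-nonNeg 0≤ε (+-nonNeg 0≤d (*-nonNeg 0≤2y+1 0≤i))))))

      y²≤a : y * y ≤ a
      y²≤a with y * y ≤? a
      ... | yes p = p
      ... | no y²≰a with difference (≰⇒≥ y²≰a)
      ...   | d , 0≤d , a+d≈y² = contradiction (antisym ε≤0 0≤ε) ε≉0
        where
        0≤2y : 0# ≤ y + y
        0≤2y = +-nonNeg 0≤y 0≤y
        2y≉0 : ¬ y + y ≈ 0#
        2y≉0 2y≈0 = y²≰a (≤-respˡ-≈ (sym (trans (*-congʳ y≈0) (zeroˡ y))) 0≤a)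
          where
          y≈0 : y ≈ 0#
          y≈0 = antisym (≤-respʳ-≈ 2y≈0 (x≤x+y y 0≤y)) 0≤y
        i = proj₁ (inverse (y + y) 2y≉0)
        2yi≈1 : (y + y) * i ≈ 1#
        2yi≈1 = proj₂ (inverse (y + y) 2y≉0)
        0≤i : 0# ≤ i
        0≤i = inverse-nonNeg 0≤2y 2yi≈1
        ε = d * i
        w = (y * y + a) * i
        0≤ε : 0# ≤ ε
        0≤ε = *-nonNeg 0≤d 0≤i
        0≤w : 0# ≤ w
        0≤w = *-nonNeg (+-nonNeg (*-nonNeg 0≤y 0≤y) 0≤a) 0≤i
        ε≉0 : ¬ ε ≈ 0#
        ε≉0 ε≈0 = y²≰a (≤-reflexive (trans (sym a+d≈y²) (trans (+-congˡ d≈0) (+-identityʳ a))))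
          where
          d≈0 : d ≈ 0#
          d≈0 = *-cancel-0 (trans (*-comm i (y + y)) 2yi≈1) ε≈0
        w+ε≈y : w + ε ≈ y
        w+ε≈y = begin
          (y * y + a) * i + d * i
            ≈⟨ solve 4 (λ y a d i → (y :* y :+ a) :* i :+ d :* i
                                  := (y :* y :+ (a :+ d)) :* i) refl y a d i ⟩
          (y * y + (a + d)) * i
            ≈⟨ *-congʳ (+-congˡ a+d≈y²) ⟩
          (y * y + y * y) * i
            ≈⟨ solve 2 (λ y i → (y :* y :+ y :* y) :* i := y :* ((y :+ y) :* i)) refl y i ⟩
          y * ((y + y) * i)
            ≈⟨ trans (*-congˡ 2yi≈1) (*-identityʳ y) ⟩
          y ∎
        d≈2yε : d ≈ (y + y) * ε
        d≈2yε = begin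
          d                  ≈⟨ sym (*-identityʳ d) ⟩
          d * 1#             ≈⟨ *-congˡ (sym 2yi≈1) ⟩
          d * ((y + y) * i)  ≈⟨ solve 3 (λ y d i → d :* ((y :+ y) :* i) := (y :+ y) :* (d :* i)) refl y d i ⟩
          (y + y) * ε        ∎
        w²≈a+ε² : w * w ≈ a + ε * ε
        w²≈a+ε² = +-cancel ((w + w) * ε + ε * ε) (begin
          (w + w) * ε + ε * ε + w * w
            ≈⟨ solve 2 (λ w ε → (w :+ w) :* ε :+ ε :* ε :+ w :* w
                              := (w :+ ε) :* (w :+ ε)) refl w ε ⟩
          (w + ε) * (w + ε)
            ≈⟨ *-cong w+ε≈y w+ε≈y ⟩
          y * y
            ≈⟨ sym a+d≈y² ⟩
          a + d
            ≈⟨ +-congˡ d≈2yε ⟩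
          a + (y + y) * ε
            ≈⟨ +-congˡ (*-congʳ (+-cong (sym w+ε≈y) (sym w+ε≈y))) ⟩
          a + ((w + ε) + (w + ε)) * ε
            ≈⟨ solve 3 (λ w ε a → a :+ ((w :+ ε) :+ (w :+ ε)) :* ε
                                := (w :+ w) :* ε :+ ε :* ε :+ (a :+ ε :* ε)) refl w ε a ⟩
          (w + w) * ε + ε * ε + (a + ε * ε) ∎)
        wBound : UpperBound (λ x → x * x ≤ a) w
        wBound x x²≤a with x ≤? w
        ... | yes p = p
        ... | no  p = contradiction
          (*-cancel-0 (proj₂ (inverse ε ε≉0)) (antisym ε²≤0 (*-nonNeg 0≤ε 0≤ε))) ε≉0
          where
          ε²≤0 : ε * ε ≤ 0#
          ε²≤0 = +-cancel-≤ a (≤-respˡ-≈ w²≈a+ε² (≤-trans (square-mono 0≤w (≰⇒≥ p)) x²≤a))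
        ε≤0 : ε ≤ 0#
        ε≤0 = +-cancel-≤ w (≤-respˡ-≈ (sym w+ε≈y) (isLeast w wBound))

  squareRoot : ∀ a → 0# ≤ a → ∃ λ y → 0# ≤ y × y * y ≈ a
  squareRoot a 0≤a = y a 0≤a , 0≤y a 0≤a , antisym (y²≤a a 0≤a) (a≤y² a 0≤a)

module Matrices {c ℓ} (R : RawRing c ℓ) where
  open RawRing R
  open RawSemiringDefs rawSemiring using (sum; _^_)

  infixl 7 _⊛_
  infixl 6 _⊖_ _⊕_

  Matrix : ℕ → ℕ → Set c
  Matrix m n = Vector (Vector Carrier n) m

  zeros : ∀ m n → Matrix m n
  zeros m n i j = 0#

  diagonal : ∀ {n} → Vector Carrier n → Matrix n n
  diagonal d i j with i Fin.≟ j
  ... | yes _ = d i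
  ... | no  _ = 0#

  identity : ∀ n → Matrix n n
  identity n = diagonal (λ _ → 1#)

  _ᵀ : ∀ {m n} → Matrix m n → Matrix n m
  (A ᵀ) i j = A j i

  _⊖_ : ∀ {m n} → Matrix m n → Matrix m n → Matrix m n
  (A ⊖ B) i j = A i j + - B i j

  _⊛_ : ∀ {l m n} → Matrix l m → Matrix m n → Matrix l n
  (A ⊛ B) i k = sum (λ j → A i j * B j k)

  rowSum : ∀ {m n} → Matrix m n → Vector Carrier m
  rowSum A i = sum (A i)

  block : ∀ {m m′ n n′} → Matrix m n → Matrix m n′ →
          Matrix m′ n → Matrix m′ n′ → Matrix (m ℕ.+ m′) (n ℕ.+ n′)
  block {m} {n = n} A B C D i j =
    [ (λ i₁ → [ A i₁ , B i₁ ]′ (splitAt n j))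
    , (λ i₂ → [ C i₂ , D i₂ ]′ (splitAt n j)) ]′ (splitAt m i)

  _⊕_ : ∀ {m n} → Matrix m m → Matrix n n → Matrix (m ℕ.+ n) (m ℕ.+ n)
  _⊕_ {m} {n} A B = block A (zeros m n) (zeros n m) B

  rowOfCopies : ∀ k {m n} → Matrix m n → Matrix m (k ℕ.* n)
  rowOfCopies k {n = n} A i j = A i (remainder {k} n j)

  columnOfCopies : ∀ k {m n} → Matrix m n → Matrix (k ℕ.* m) n
  columnOfCopies k {m} A i j = A (remainder {k} m i) j

  -- Laplace expansion along the first row.
  det : ∀ {n} → Matrix n n → Carrier
  det {zero}  A = 1#
  det {suc n} A =
    sum (λ j → (- 1#) ^ toℕ j * A zero j * det (λ i k → A (suc i) (punchIn j k)))

-- Univariate polynomials as coefficient lists, constant term first, compared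
-- coefficientwise so that trailing zeros are irrelevant.

module Polynomials {c ℓ} (R : RawRing c ℓ) where
  open RawRing R

  Polynomial : Set c
  Polynomial = List Carrier

  coefficient : Polynomial → ℕ → Carrier
  coefficient []      k       = 0#
  coefficient (a ∷ p) zero    = a
  coefficient (a ∷ p) (suc k) = coefficient p k

  constant : Carrier → Polynomial
  constant a = a ∷ []

  X : Polynomial
  X = 0# ∷ 1# ∷ []

  add : Polynomial → Polynomial → Polynomial
  add []      q       = q
  add (a ∷ p) []      = a ∷ p
  add (a ∷ p) (b ∷ q) = a + b ∷ add p q

  multiply : Polynomial → Polynomial → Polynomial
  multiply []      q = []
  multiply (a ∷ p) q = add (map (a *_) q) (0# ∷ multiply p q)

  polynomialRing : RawRing c ℓ
  polynomialRing = record
    { Carrier = Polynomial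
    ; _≈_     = λ p q → ∀ k → coefficient p k ≈ coefficient q k
    ; _+_     = add
    ; _*_     = multiply
    ; -_      = map -_
    ; 0#      = []
    ; 1#      = constant 1#
    }

module Spectrum {c ℓ} (K : RawRing c ℓ) where
  open RawRing K
  open RawSemiringDefs rawSemiring using (sum)
  open Matrices K using (Matrix)
  open Polynomials K

  private
    module Poly where
      open RawRing polynomialRing public
      open RawSemiringDefs (RawRing.rawSemiring polynomialRing) public using (_^_; _∣_)
      open Matrices polynomialRing public using (diagonal; _⊖_; det)

  IsEigenvalue : ∀ {n} → Matrix n n → Carrier → Set (c ⊔ ℓ)
  IsEigenvalue {n} A μ = Σ (Vector Carrier n) λ v →
    (¬ (∀ i → v i ≈ 0#)) × (∀ i → sum (λ j → A i j * v j) ≈ μ * v i)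

  characteristicPolynomial : ∀ {n} → Matrix n n → Polynomial
  characteristicPolynomial A =
    Poly.det (Poly.diagonal (λ _ → X) Poly.⊖ (λ i j → constant (A i j)))

  -- The algebraic multiplicity of μ is m.
  HasMultiplicity : ∀ {n} → Matrix n n → Carrier → ℕ → Set (c ⊔ ℓ)
  HasMultiplicity A μ m =
    ((X-μ Poly.^ m) Poly.∣ characteristicPolynomial A) ×
    (¬ ((X-μ Poly.^ suc m) Poly.∣ characteristicPolynomial A))
    where
    X-μ : Polynomial
    X-μ = X Poly.+ Poly.- constant μ

  SameSpectrum : ∀ {m n} → Matrix m m → Matrix n n → Set (c ⊔ ℓ)
  SameSpectrum A B = ∀ μ →
    (IsEigenvalue A μ ⇔ IsEigenvalue B μ) ×
    (∀ k → HasMultiplicity A μ k ⇔ HasMultiplicity B μ k)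

complex : ∀ {c ℓ} → RawRing c ℓ → RawRing c ℓ
complex R = record
  { Carrier = Carrier × Carrier
  ; _≈_     = λ { (a , b) (a′ , b′) → a ≈ a′ × b ≈ b′ }
  ; _+_     = λ { (a , b) (a′ , b′) → a + a′ , b + b′ }
  ; _*_     = λ { (a , b) (a′ , b′) → a * a′ + - (b * b′) , a * b′ + b * a′ }
  ; -_      = λ { (a , b) → - a , - b }
  ; 0#      = 0# , 0#
  ; 1#      = 1# , 0#
  }
  where open RawRing R

module RealMatrices {c ℓ₁ ℓ₂} (ℝ : CompleteOrderedField c ℓ₁ ℓ₂) where
  open CompleteOrderedField ℝ
  open SquareRoot ℝ using (squareRoot)

  open Matrices rawRing public

  NonNegative : ∀ {m n} → Matrix m n → Set ℓ₂
  NonNegative A = ∀ i j → 0# ≤ A i j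

  -- The nonnegative square root; the value 0 at negative arguments is junk.
  √ : Carrier → Carrier
  √ x with 0# ≤? x
  ... | yes 0≤x = proj₁ (squareRoot x 0≤x)
  ... | no  _   = 0#

  infix 9 _†
  _† : Carrier → Carrier
  x † with x ≟ 0#
  ... | yes _   = 0#
  ... | no  x≉0 = proj₁ (inverse x x≉0)

  -- The Moore–Penrose inverse of the diagonal matrix Δ of row sums is the
  -- diagonal matrix with entries (rowSum M i) †, so √Δ† below is (Δ†)^{1/2}.
  normalizedLaplacian : ∀ {n} → Matrix n n → Matrix n n
  normalizedLaplacian {n} M = identity n ⊖ √Δ† ⊛ M ⊛ √Δ†
    where
    √Δ† : Matrix n n
    √Δ† = diagonal (λ i → √ (rowSum M i †))

  -- Eigenvalues of a real matrix are taken in ℂ.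
  Cospectral : ∀ {m n} → Matrix m m → Matrix n n → Set (c ⊔ ℓ₁)
  Cospectral A B =
    Spectrum.SameSpectrum (complex rawRing) (λ i j → A i j , 0#) (λ i j → B i j , 0#)

  matrixC : ∀ n {p q} → Matrix p q → Matrix (p ℕ.+ n ℕ.* q) (p ℕ.+ n ℕ.* q)
  matrixC n {p} {q} B =
    block (zeros p p)              (rowOfCopies n B)
          (columnOfCopies n (B ᵀ)) (zeros (n ℕ.* q) (n ℕ.* q))

  matrixD : ∀ n {p q} → Matrix p q → Matrix (q ℕ.+ n ℕ.* p) (q ℕ.+ n ℕ.* p)
  matrixD n {p} {q} B =
    block (zeros q q)          (rowOfCopies n (B ᵀ))
          (columnOfCopies n B) (zeros (n ℕ.* p) (n ℕ.* p))

{-# OPTIONS --safe #-}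

-- Write r and c for the row and column sums of B, and let
-- G i j = B i j / √(n · r i · c j).  The first p row sums of C are n · r and
-- the others are c; for D they are n · c and r.  Hence
-- L(C ⊕ 0) = I - (C(G) ⊕ 0) and L(D) = I - D(G), where C(G) and D(G) are the
-- block matrices built from G.  On a vector (x, y₁, …, yₙ), the matrix C(G)
-- acts on x and ∑ yₖ only, and it kills the deviations yₖ - (1/n) ∑ yₖ;
-- likewise for D(G) with the roles of x and y exchanged.  Matching ∑ yₖ with y
-- and n · x with ∑ xₖ, and identifying the m = n - 1 deviations in ℝ^q,
-- completed by the m (p - q) extra coordinates, with the m deviations in ℝ^p
-- gives an invertible matrix that conjugates one Laplacian into the other.
-- Similar matrices have the same eigenvalues, and the same characteristic
-- polynomial because the determinant is multiplicative.

module Submission where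

open import Algebra.Bundles using (CommutativeRing)
open import Algebra.Bundles.Raw using (RawRing)
import Algebra.Definitions.RawSemiring as RawSemiringDefs
open import Algebra.Morphism.Structures using (IsSemiringHomomorphism)
import Algebra.Properties.CommutativeSemigroup as CommutativeSemigroupProperties
import Algebra.Properties.Magma.Divisibility as MagmaDivisibility
import Algebra.Properties.Ring as RingProperties
import Algebra.Properties.Semiring.Sum as SemiringSum
import Algebra.Solver.Ring.NaturalCoefficients.Default as SemiringSolver
open import Data.Fin.Base using (Fin; zero; suc; _↑ˡ_; _↑ʳ_; splitAt; combine; remQuot; punchIn; pinch; toℕ)
import Data.Fin.Properties as Fin
open import Data.Nat.Base as ℕ using (ℕ; zero; suc)
import Data.Nat.Properties as ℕ
open import Data.Nat.Solver using (module +-*-Solver)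
open import Data.Product.Base using (_×_; _,_; proj₁; proj₂; uncurry)
open import Data.Sum.Base using (inj₁; inj₂; [_,_]′)
open import Data.Unit.Polymorphic.Base using (⊤; tt)
open import Data.Vec.Functional using (Vector; _++_)
open import Data.Vec.Functional.Properties using (lookup-++ˡ; lookup-++ʳ)
open import Function.Base using (_∘_)
open import Function.Bundles using (mk⇔)
open import Level using (Level; _⊔_)
open import Relation.Binary.PropositionalEquality.Core as ≡ using (_≡_; _≢_)
import Relation.Binary.Reasoning.Setoid as SetoidReasoning
open import Relation.Nullary using (¬_; yes; no; contradiction)
open import Defs

-- Determinants

-- One `G` serves both matrices because the factor n belongs to the row sum r on the side of C and
-- to c on the side of D: at each entry of `B` the product of the two weights is the same. Where a
-- row sum vanishes the weight is 0, so the weighted matrix has a zero row there, in agreement with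
-- the convention that L has diagonal entry 1 at such a row. The similarity of the block matrices
-- divides by nothing except n.
--
-- Multiplicities are read off the characteristic polynomial, a determinant over ℂ[X], which is not
-- a field, and `det` is given only by expansion along the first row. Its multiplicativity is
-- therefore derived over an arbitrary commutative ring, from the fact that an alternating form on
-- square matrices is `det` times its value at the identity.
--
-- The two Laplacians have sizes that agree only by arithmetic. Similarity is thus stated for
-- matrices of possibly different sizes, and the equality of sizes enters only where determinants
-- are compared.

punchIn-pinch : ∀ {n} (j : Fin (suc (suc n))) (k : Fin (suc n)) →
                punchIn (punchIn j k) (pinch k j) ≡ j
punchIn-pinch zero    k       = ≡.refl
punchIn-pinch (suc j) zero    = ≡.refl
punchIn-pinch {suc n} (suc j) (suc k) = ≡.cong suc (punchIn-pinch j k)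

-- A pair `(j , k)` codes the ordered pair of distinct columns `j` and `punchIn j k`. By
-- `punchIn-pinch` the same two columns in reverse order have the code `(punchIn j k , pinch k j)`.
-- Deleting them in either order leaves the same columns in the same positions, so the two
-- second-order minors agree.
punchIn-exchange : ∀ {n} (j : Fin (suc (suc n))) (k : Fin (suc n)) (l : Fin n) →
  punchIn j (punchIn k l) ≡ punchIn (punchIn j k) (punchIn (pinch k j) l)
punchIn-exchange zero    k       l       = ≡.refl
punchIn-exchange (suc j) zero    l       = ≡.refl
punchIn-exchange (suc j) (suc k) zero    = ≡.refl
punchIn-exchange (suc j) (suc k) (suc l) = ≡.cong suc (punchIn-exchange j k l)

module MatrixProperties {c ℓ} (R : CommutativeRing c ℓ) where
  open CommutativeRing R hiding (zero)
  open SemiringSum semiring public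
    using (sum; sum-cong-≋; sum-remove; sum-replicate-zero; ∑-distrib-+; ∑-comm; *-distribˡ-sum; *-distribʳ-sum)
  open Matrices rawRing
  open SetoidReasoning setoid

  sum-zero : ∀ {n} {f : Vector Carrier n} → (∀ i → f i ≈ 0#) → sum f ≈ 0#
  sum-zero {n} f≈0 = trans (sum-cong-≋ f≈0) (sum-replicate-zero n)

  sum-combination : ∀ {n} x y (f g : Vector Carrier n) →
                    sum (λ j → x * f j + y * g j) ≈ x * sum f + y * sum g
  sum-combination x y f g = trans
    (∑-distrib-+ (λ j → x * f j) (λ j → y * g j))
    (sym (+-cong (*-distribˡ-sum x f) (*-distribˡ-sum y g)))

  sum-select : ∀ {n} (i : Fin n) (f : Vector Carrier n) → (∀ j → j ≢ i → f j ≈ 0#) → sum f ≈ f i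
  sum-select {suc n} i f f≈0 = begin
    sum f                        ≈⟨ sum-remove {i = i} f ⟩
    f i + sum (f ∘ punchIn i)    ≈⟨ +-congˡ (sum-zero λ j → f≈0 (punchIn i j) (Fin.punchInᵢ≢i i j)) ⟩
    f i + 0#                     ≈⟨ +-identityʳ (f i) ⟩
    f i                          ∎

  diagonal-≡ : ∀ {n} (d : Vector Carrier n) i → diagonal d i i ≈ d i
  diagonal-≡ d i with i Fin.≟ i
  ... | yes _ = refl
  ... | no i≢i = contradiction ≡.refl i≢i

  diagonal-≢ : ∀ {n} (d : Vector Carrier n) {i j} → i ≢ j → diagonal d i j ≈ 0#
  diagonal-≢ d {i} {j} i≢j with i Fin.≟ j
  ... | yes i≡j = contradiction i≡j i≢j
  ... | no  _   = refl

  diagonalˡ : ∀ {n} (d v : Vector Carrier n) i → sum (λ j → diagonal d i j * v j) ≈ d i * v i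
  diagonalˡ d v i = trans
    (sum-select i _ λ j j≢i → trans (*-congʳ (diagonal-≢ d (j≢i ∘ ≡.sym))) (zeroˡ _))
    (*-congʳ (diagonal-≡ d i))

  diagonalʳ : ∀ {n} (v d : Vector Carrier n) i → sum (λ j → v j * diagonal d j i) ≈ v i * d i
  diagonalʳ v d i = trans
    (sum-select i _ λ j j≢i → trans (*-congˡ (diagonal-≢ d j≢i)) (zeroʳ _))
    (*-congˡ (diagonal-≡ d i))

  identityˡ : ∀ {m n} (A : Matrix m n) i k → (identity m ⊛ A) i k ≈ A i k
  identityˡ A i k = trans (diagonalˡ _ (λ j → A j k) i) (*-identityˡ _)

  identityʳ : ∀ {m n} (A : Matrix m n) i k → (A ⊛ identity n) i k ≈ A i k
  identityʳ A i k = trans (diagonalʳ (A i) _ k) (*-identityʳ _)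

  ⊛-assoc : ∀ {k l m n} (A : Matrix k l) (B : Matrix l m) (C : Matrix m n) i j →
            ((A ⊛ B) ⊛ C) i j ≈ (A ⊛ (B ⊛ C)) i j
  ⊛-assoc A B C i j = begin
    sum (λ b → sum (λ a → A i a * B a b) * C b j)    ≈⟨ sum-cong-≋ (λ b → *-distribʳ-sum (C b j) (λ a → A i a * B a b)) ⟩
    sum (λ b → sum (λ a → A i a * B a b * C b j))    ≈⟨ ∑-comm (λ b a → A i a * B a b * C b j) ⟩
    sum (λ a → sum (λ b → A i a * B a b * C b j))    ≈⟨ sum-cong-≋ (λ a → sum-cong-≋ λ b → *-assoc (A i a) (B a b) (C b j)) ⟩
    sum (λ a → sum (λ b → A i a * (B a b * C b j)))  ≈⟨ sum-cong-≋ (λ a → *-distribˡ-sum (A i a) (λ b → B a b * C b j)) ⟨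
    sum (λ a → A i a * sum (λ b → B a b * C b j))    ∎

-- Alternating forms and multiplicativity of the determinant.

module Determinant {c ℓ} (R : CommutativeRing c ℓ) where
  open import Data.Vec.Functional using (_∷_; insertAt)
  open CommutativeRing R hiding (zero)
  open Matrices rawRing
  open MatrixProperties R
  open RawSemiringDefs (RawRing.rawSemiring rawRing) using (_^_)
  open RingProperties ring
    using (-‿distribʳ-*; -1*x≈-x; -‿involutive; -0#≈0#; +-inverseʳ-unique)
  open SetoidReasoning setoid
  open SemiringSolver commutativeSemiring using (solve; _:=_; _:+_; _:*_)

  private
    variable
      m n : ℕ

  infix 4 _≋_
  _≋_ : Matrix m n → Matrix m n → Set ℓ
  A ≋ B = ∀ i j → A i j ≈ B i j

  -- Matrices are functions and function extensionality is not assumed, so respecting entrywise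
  -- equality has to be a separate hypothesis on a form; already rewriting `A` as `A zero ∷ A ∘ suc`
  -- depends on it.
  Congruent : (Matrix m n → Carrier) → Set (c ⊔ ℓ)
  Congruent f = ∀ {A B} → A ≋ B → f A ≈ f B

  combination : Carrier → Carrier → Vector Carrier n → Vector Carrier n → Vector Carrier n
  combination x y u v j = x * u j + y * v j

  -- Vanishing is only demanded for adjacent equal rows.
  IsAlternating : ∀ m → (Matrix m n → Carrier) → Set (c ⊔ ℓ)
  VanishesOnEqualHeads : ∀ m → (Matrix (suc m) n → Carrier) → Set (c ⊔ ℓ)

  IsAlternating zero    f = ⊤
  IsAlternating (suc m) f =
    (∀ x y u v A → f (combination x y u v ∷ A) ≈ x * f (u ∷ A) + y * f (v ∷ A)) ×
    VanishesOnEqualHeads m f ×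
    (∀ v → IsAlternating m (λ A → f (v ∷ A)))

  VanishesOnEqualHeads zero    f = ⊤
  VanishesOnEqualHeads (suc m) f = ∀ v A → f (v ∷ v ∷ A) ≈ 0#

  ∷-congˡ : ∀ {v : Vector Carrier n} {A B : Matrix m n} → A ≋ B → (v ∷ A) ≋ (v ∷ B)
  ∷-congˡ A≋B zero    j = refl
  ∷-congˡ A≋B (suc i) j = A≋B i j

  ∷-congʳ : ∀ {u v : Vector Carrier n} {A : Matrix m n} → (∀ j → u j ≈ v j) → (u ∷ A) ≋ (v ∷ A)
  ∷-congʳ u≋v zero    j = u≋v j
  ∷-congʳ u≋v (suc i) j = refl

  ∷-η : ∀ (A : Matrix (suc m) n) → A ≋ (A zero ∷ A ∘ suc)
  ∷-η A zero    j = refl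
  ∷-η A (suc i) j = refl

  section-cong : ∀ {f : Matrix (suc m) n → Carrier} → Congruent f → ∀ v → Congruent (λ A → f (v ∷ A))
  section-cong f-cong v A≋B = f-cong (∷-congˡ A≋B)

  alternating-resp : ∀ {m n} {f g : Matrix m n → Carrier} → (∀ A → f A ≈ g A) →
                     IsAlternating m f → IsAlternating m g
  alternating-resp {zero}  f≈g _ = tt
  alternating-resp {suc m} {f = f} {g} f≈g (lin , van , sec) =
    (λ x y u v A → trans (sym (f≈g _)) (trans (lin x y u v A) (+-cong (*-congˡ (f≈g _)) (*-congˡ (f≈g _))))) ,
    vanishes m f≈g van ,
    (λ v → alternating-resp (λ A → f≈g (v ∷ A)) (sec v))
    where
    vanishes : ∀ m {n} {f g : Matrix (suc m) n → Carrier} → (∀ A → f A ≈ g A) →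
               VanishesOnEqualHeads m f → VanishesOnEqualHeads m g
    vanishes zero    f≈g _   = tt
    vanishes (suc m) f≈g van v A = trans (sym (f≈g _)) (van v A)

  -- Meant for the Laplace expansion: with the first row fixed, the determinant is such a
  -- combination of its minors.
  alternating-sum : ∀ {m n k} (a : Vector Carrier k) (f : Fin k → Matrix m n → Carrier) →
    (∀ j → IsAlternating m (f j)) → IsAlternating m (λ A → sum (λ j → a j * f j A))
  alternating-sum {zero}  a f alt = tt
  alternating-sum {suc m} {n} {k} a f alt =
    linear , vanishes m a f (proj₁ ∘ proj₂ ∘ alt) ,
    λ v → alternating-sum a (λ j A → f j (v ∷ A)) (λ j → proj₂ (proj₂ (alt j)) v)
    where
    linear : ∀ x y u v A → sum (λ j → a j * f j (combination x y u v ∷ A)) ≈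
             x * sum (λ j → a j * f j (u ∷ A)) + y * sum (λ j → a j * f j (v ∷ A))
    linear x y u v A = begin
      sum (λ j → a j * f j (combination x y u v ∷ A))
        ≈⟨ sum-cong-≋ (λ j → trans (*-congˡ (proj₁ (alt j) x y u v A))
             (solve 5 (λ a x y s t → a :* (x :* s :+ y :* t) := x :* (a :* s) :+ y :* (a :* t)) refl
                (a j) x y (f j (u ∷ A)) (f j (v ∷ A)))) ⟩
      sum (λ j → x * (a j * f j (u ∷ A)) + y * (a j * f j (v ∷ A)))
        ≈⟨ sum-combination x y (λ j → a j * f j (u ∷ A)) (λ j → a j * f j (v ∷ A)) ⟩
      x * sum (λ j → a j * f j (u ∷ A)) + y * sum (λ j → a j * f j (v ∷ A)) ∎
    vanishes : ∀ m {n k} (a : Vector Carrier k) (f : Fin k → Matrix (suc m) n → Carrier) →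
      (∀ j → VanishesOnEqualHeads m (f j)) → VanishesOnEqualHeads m (λ A → sum (λ j → a j * f j A))
    vanishes zero    a f van = tt
    vanishes (suc m) a f van v A = sum-zero λ j → trans (*-congˡ (van j v A)) (zeroʳ (a j))

  record IsLinearMap (φ : Vector Carrier m → Vector Carrier n) : Set (c ⊔ ℓ) where
    field
      φ-cong : ∀ {u v} → (∀ j → u j ≈ v j) → ∀ j → φ u j ≈ φ v j
      φ-linear : ∀ x y u v j → φ (combination x y u v) j ≈ combination x y (φ u) (φ v) j

  -- Applying one linear map to every row preserves alternation. It serves for three maps: deleting
  -- a column in `det-alternating`, inserting a zero in `alternating-unique`, and multiplying by a
  -- matrix on the right in `det-*`.
  alternating-∘ : ∀ {m n k} {φ : Vector Carrier k → Vector Carrier n} → IsLinearMap φ →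
    {f : Matrix m n → Carrier} → Congruent f → IsAlternating m f → IsAlternating m (λ A → f (φ ∘ A))
  alternating-∘ {zero}  lin f-cong alt = tt
  alternating-∘ {suc m} {n} {k} {φ} lin {f} f-cong (f-linear , f-van , f-sec) =
    (λ x y u v A → trans (f-cong (λ { zero j → φ-linear x y u v j ; (suc i) j → refl }))
        (trans (f-linear x y (φ u) (φ v) (φ ∘ A)) (+-cong (*-congˡ (f-cong (push u A))) (*-congˡ (f-cong (push v A)))))) ,
    vanishes m f-cong f-van ,
    λ v → alternating-resp (λ A → f-cong (push v A))
            (alternating-∘ lin (section-cong {f = f} f-cong (φ v)) (f-sec (φ v)))
    where
    open IsLinearMap lin
    push : ∀ {m} v (A : Matrix m k) → (φ v ∷ φ ∘ A) ≋ (φ ∘ (v ∷ A))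
    push v A zero    j = refl
    push v A (suc i) j = refl
    vanishes : ∀ m {f : Matrix (suc m) n → Carrier} → Congruent f →
      VanishesOnEqualHeads m f → VanishesOnEqualHeads m (λ A → f (φ ∘ A))
    vanishes zero    _      _   = tt
    vanishes (suc m) f-cong van v A = trans
      (f-cong λ { zero j → refl ; (suc zero) j → refl ; (suc (suc i)) j → refl }) (van (φ v) (φ ∘ A))

  module _ {m n} {f : Matrix (suc m) n → Carrier} (f-cong : Congruent f) (alt : IsAlternating (suc m) f) where

    head-scale : ∀ x u A → f ((λ j → x * u j) ∷ A) ≈ x * f (u ∷ A)
    head-scale x u A = begin
      f ((λ j → x * u j) ∷ A)         ≈⟨ f-cong (∷-congʳ λ j → sym (trans (+-congˡ (zeroˡ (u j))) (+-identityʳ _))) ⟩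
      f (combination x 0# u u ∷ A)    ≈⟨ proj₁ alt x 0# u u A ⟩
      x * f (u ∷ A) + 0# * f (u ∷ A)  ≈⟨ +-congˡ (zeroˡ _) ⟩
      x * f (u ∷ A) + 0#              ≈⟨ +-identityʳ _ ⟩
      x * f (u ∷ A)                   ∎

    head-+* : ∀ y u v A → f ((λ j → u j + y * v j) ∷ A) ≈ f (u ∷ A) + y * f (v ∷ A)
    head-+* y u v A = begin
      f ((λ j → u j + y * v j) ∷ A)   ≈⟨ f-cong (∷-congʳ λ j → +-congʳ (*-identityˡ (u j))) ⟨
      f (combination 1# y u v ∷ A)    ≈⟨ proj₁ alt 1# y u v A ⟩
      1# * f (u ∷ A) + y * f (v ∷ A)  ≈⟨ +-congʳ (*-identityˡ _) ⟩
      f (u ∷ A) + y * f (v ∷ A)       ∎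

    head-+ : ∀ u v A → f ((λ j → u j + v j) ∷ A) ≈ f (u ∷ A) + f (v ∷ A)
    head-+ u v A = begin
      f ((λ j → u j + v j) ∷ A)       ≈⟨ f-cong (∷-congʳ λ j → +-congˡ (*-identityˡ (v j))) ⟨
      f ((λ j → u j + 1# * v j) ∷ A)  ≈⟨ head-+* 1# u v A ⟩
      f (u ∷ A) + 1# * f (v ∷ A)      ≈⟨ +-congˡ (*-identityˡ _) ⟩
      f (u ∷ A) + f (v ∷ A)           ∎

    head-sum : ∀ {k} (a : Vector Carrier k) (v : Fin k → Vector Carrier n) A →
               f ((λ i → sum (λ j → a j * v j i)) ∷ A) ≈ sum (λ j → a j * f (v j ∷ A))
    head-sum {zero}  a v A = begin
      f ((λ _ → 0#) ∷ A)            ≈⟨ f-cong (∷-congʳ λ j → zeroˡ 0#) ⟨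
      f ((λ _ → 0# * 0#) ∷ A)       ≈⟨ head-scale 0# (λ _ → 0#) A ⟩
      0# * f ((λ _ → 0#) ∷ A)       ≈⟨ zeroˡ _ ⟩
      0#                            ∎
    head-sum {suc k} a v A = begin
      f ((λ i → a zero * v zero i + sum (λ j → a (suc j) * v (suc j) i)) ∷ A)
        ≈⟨ head-+ (λ i → a zero * v zero i) (λ i → sum (λ j → a (suc j) * v (suc j) i)) A ⟩
      f ((λ i → a zero * v zero i) ∷ A) + f ((λ i → sum (λ j → a (suc j) * v (suc j) i)) ∷ A)
        ≈⟨ +-cong (head-scale (a zero) (v zero) A) (head-sum (a ∘ suc) (v ∘ suc) A) ⟩
      a zero * f (v zero ∷ A) + sum (λ j → a (suc j) * f (v (suc j) ∷ A)) ∎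

  -- Polarization: expanding the vanishing value at two equal rows u + v leaves the two mixed terms,
  -- whose sum is therefore zero.
  swap-heads : ∀ {m n} {f : Matrix (suc (suc m)) n → Carrier} → Congruent f → IsAlternating (suc (suc m)) f →
               ∀ u v A → f (u ∷ v ∷ A) ≈ - f (v ∷ u ∷ A)
  swap-heads {m} {n} {f} f-cong alt u v A = +-inverseʳ-unique (f (v ∷ u ∷ A)) (f (u ∷ v ∷ A)) (begin
    f (v ∷ u ∷ A) + f (u ∷ v ∷ A)
      ≈⟨ +-comm _ _ ⟩
    f (u ∷ v ∷ A) + f (v ∷ u ∷ A)
      ≈⟨ +-cong (+-identityˡ _) (+-identityʳ _) ⟨
    (0# + f (u ∷ v ∷ A)) + (f (v ∷ u ∷ A) + 0#)
      ≈⟨ +-cong (+-congʳ (vanish u A)) (+-congˡ (vanish v A)) ⟨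
    (f (u ∷ u ∷ A) + f (u ∷ v ∷ A)) + (f (v ∷ u ∷ A) + f (v ∷ v ∷ A))
      ≈⟨ +-cong (head-+ (section-cong {f = f} f-cong u) (section u) u v A)
                (head-+ (section-cong {f = f} f-cong v) (section v) u v A) ⟨
    f (u ∷ w ∷ A) + f (v ∷ w ∷ A)
      ≈⟨ head-+ f-cong alt u v (w ∷ A) ⟨
    f (w ∷ w ∷ A)
      ≈⟨ vanish w A ⟩
    0# ∎)
    where
    w : Vector Carrier n
    w j = u j + v j
    vanish = proj₁ (proj₂ alt)
    section = proj₂ (proj₂ alt)

  -- Swapping the first two rows carries `v` one place down towards its duplicate at the cost of a
  -- sign, and the induction continues in the section at `A zero` until the two are adjacent.
  vanishes-on-repeated-head : ∀ {m n} {f : Matrix (suc m) n → Carrier} → Congruent f → IsAlternating (suc m) f →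
    ∀ v (A : Matrix m n) i → (∀ j → A i j ≈ v j) → f (v ∷ A) ≈ 0#
  vanishes-on-repeated-head {suc m} {f = f} f-cong alt v A zero    Ai≋v =
    trans (f-cong λ { zero j → refl ; (suc zero) j → Ai≋v j ; (suc (suc i)) j → refl })
          (proj₁ (proj₂ alt) v (A ∘ suc))
  vanishes-on-repeated-head {suc m} {f = f} f-cong alt v A (suc i) Ai≋v = begin
    f (v ∷ A)                         ≈⟨ f-cong (∷-congˡ (∷-η A)) ⟩
    f (v ∷ A zero ∷ A ∘ suc)          ≈⟨ swap-heads f-cong alt v (A zero) (A ∘ suc) ⟩
    - f (A zero ∷ v ∷ A ∘ suc)        ≈⟨ -‿cong (vanishes-on-repeated-head (section-cong {f = f} f-cong (A zero))
                                           (proj₂ (proj₂ alt) (A zero)) v (A ∘ suc) i Ai≋v) ⟩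
    - 0#                              ≈⟨ -0#≈0# ⟩
    0#                                ∎

  -- Meant for a form that already holds `v` as a fixed row, so that `van` is vanishing on a
  -- repeated row. The rows are cleared one at a time; each cleared row is then fixed, and `van` is
  -- inherited by the resulting section.
  shear : ∀ {m n} {f : Matrix m n → Carrier} → Congruent f → IsAlternating m f →
          (v : Vector Carrier n) → (∀ A i → (∀ j → A i j ≈ v j) → f A ≈ 0#) →
          ∀ (A B : Matrix m n) (a : Vector Carrier m) → (∀ i j → A i j ≈ B i j + a i * v j) → f A ≈ f B
  shear {zero}  f-cong alt v van A B a A≈B+av = f-cong λ ()
  shear {suc m} {f = f} f-cong alt v van A B a A≈B+av = begin
    f A
      ≈⟨ f-cong (λ { zero j → A≈B+av zero j ; (suc i) j → refl }) ⟩
    f ((λ j → B zero j + a zero * v j) ∷ A ∘ suc)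
      ≈⟨ head-+* f-cong alt (a zero) (B zero) v (A ∘ suc) ⟩
    f (B zero ∷ A ∘ suc) + a zero * f (v ∷ A ∘ suc)
      ≈⟨ +-congˡ (trans (*-congˡ (van (v ∷ A ∘ suc) zero λ _ → refl)) (zeroʳ _)) ⟩
    f (B zero ∷ A ∘ suc) + 0#
      ≈⟨ +-identityʳ _ ⟩
    f (B zero ∷ A ∘ suc)
      ≈⟨ shear (section-cong {f = f} f-cong (B zero)) (proj₂ (proj₂ alt) (B zero)) v
           (λ A′ i → van (B zero ∷ A′) (suc i)) (A ∘ suc) (B ∘ suc) (a ∘ suc) (A≈B+av ∘ suc) ⟩
    f (B zero ∷ B ∘ suc)
      ≈⟨ f-cong (∷-η B) ⟨
    f B ∎

  sign : Fin n → Carrier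
  sign j = (- 1#) ^ toℕ j

  -- Bringing row `j` to the top is a product of `toℕ j` adjacent swaps, each contributing a factor
  -- -1.
  rotate : ∀ {m n} {f : Matrix (suc m) n → Carrier} → Congruent f → IsAlternating (suc m) f →
           ∀ (v : Matrix (suc m) n) j → f (v j ∷ v ∘ punchIn j) ≈ sign j * f v
  rotate {f = f} f-cong alt v zero = trans (f-cong (λ i j → sym (∷-η v i j))) (sym (*-identityˡ _))
  rotate {suc m} {f = f} f-cong alt v (suc j) = begin
    f (v (suc j) ∷ v ∘ punchIn (suc j))
      ≈⟨ f-cong (∷-congˡ (∷-η (v ∘ punchIn (suc j)))) ⟩
    f (v (suc j) ∷ v zero ∷ (v ∘ suc) ∘ punchIn j)
      ≈⟨ swap-heads f-cong alt (v (suc j)) (v zero) ((v ∘ suc) ∘ punchIn j) ⟩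
    - f (v zero ∷ v (suc j) ∷ (v ∘ suc) ∘ punchIn j)
      ≈⟨ -‿cong (rotate (section-cong {f = f} f-cong (v zero)) (proj₂ (proj₂ alt) (v zero)) (v ∘ suc) j) ⟩
    - (sign j * f (v zero ∷ v ∘ suc))
      ≈⟨ -‿cong (*-congˡ (f-cong (∷-η v))) ⟨
    - (sign j * f v)
      ≈⟨ -1*x≈-x _ ⟨
    - 1# * (sign j * f v)
      ≈⟨ *-assoc _ _ _ ⟨
    sign (suc j) * f v ∎

  det-cong : ∀ {n} → Congruent (det {n})
  det-cong {zero}  A≋B = refl
  det-cong {suc n} A≋B = sum-cong-≋ λ j →
    *-cong (*-congˡ {sign j} (A≋B zero j)) (det-cong λ i k → A≋B (suc i) (punchIn j k))

  -- Induction peels off all pairs involving column zero: those with it first cancel against those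
  -- with it second, and the other pairs form a smaller instance. Cancelling term by term, instead
  -- of showing S = -S, keeps the argument valid where 2 cannot be cancelled.
  sum-cancel-pairs : ∀ {n} (g : Fin (suc n) → Fin n → Carrier) →
    (∀ j k → g j k + g (punchIn j k) (pinch k j) ≈ 0#) → sum (λ j → sum (g j)) ≈ 0#
  sum-cancel-pairs {zero}  g cancel = +-identityʳ 0#
  sum-cancel-pairs {suc n} g cancel = begin
    sum (g zero) + sum (λ j → g (suc j) zero + sum (λ k → g (suc j) (suc k)))
      ≈⟨ +-congˡ (∑-distrib-+ (λ j → g (suc j) zero) (λ j → sum (λ k → g (suc j) (suc k)))) ⟩
    sum (g zero) + (sum (λ j → g (suc j) zero) + sum (λ j → sum (λ k → g (suc j) (suc k))))
      ≈⟨ +-assoc _ _ _ ⟨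
    (sum (g zero) + sum (λ j → g (suc j) zero)) + sum (λ j → sum (λ k → g (suc j) (suc k)))
      ≈⟨ +-cong (trans (sym (∑-distrib-+ (g zero) (λ j → g (suc j) zero))) (sum-zero (cancel zero)))
                (sum-cancel-pairs (λ j k → g (suc j) (suc k)) (λ j k → cancel (suc j) (suc k))) ⟩
    0# + 0#
      ≈⟨ +-identityʳ 0# ⟩
    0# ∎

  -- Reversing an ordered pair of columns changes the sum of its two code numbers by exactly one: if
  -- `j` is the left column, `k` becomes k + 1 and `j` stays; otherwise `k` stays and `j` becomes j
  -- - 1.
  sign-exchange : ∀ {n} (j : Fin (suc n)) (k : Fin n) →
                  sign j * sign k ≈ - (sign (punchIn j k) * sign (pinch k j))
  sign-exchange {suc n} zero k = begin
    1# * sign k                  ≈⟨ *-identityˡ _ ⟩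
    sign k                       ≈⟨ -‿involutive _ ⟨
    - - sign k                   ≈⟨ -‿cong (-1*x≈-x _) ⟨
    - (- 1# * sign k)            ≈⟨ -‿cong (*-identityʳ _) ⟨
    - (- 1# * sign k * 1#)       ∎
  sign-exchange {suc n} (suc j) zero = begin
    - 1# * sign j * 1#           ≈⟨ *-identityʳ _ ⟩
    - 1# * sign j                ≈⟨ -1*x≈-x _ ⟩
    - sign j                     ≈⟨ -‿cong (*-identityˡ _) ⟨
    - (1# * sign j)              ∎
  sign-exchange {suc n} (suc j) (suc k) = begin
    - 1# * sign j * (- 1# * sign k)
      ≈⟨ regroup (sign j) (sign k) ⟩
    - 1# * - 1# * (sign j * sign k)
      ≈⟨ *-congˡ (sign-exchange j k) ⟩
    - 1# * - 1# * - (sign (punchIn j k) * sign (pinch k j))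
      ≈⟨ -‿distribʳ-* _ _ ⟨
    - (- 1# * - 1# * (sign (punchIn j k) * sign (pinch k j)))
      ≈⟨ -‿cong (regroup (sign (punchIn j k)) (sign (pinch k j))) ⟨
    - (- 1# * sign (punchIn j k) * (- 1# * sign (pinch k j))) ∎
    where
    regroup : ∀ s t → - 1# * s * (- 1# * t) ≈ - 1# * - 1# * (s * t)
    regroup s t = solve 3 (λ e s t → e :* s :* (e :* t) := e :* e :* (s :* t)) refl (- 1#) s t

  -- Expanding along the first two rows gives a sum over ordered pairs of distinct columns. For
  -- equal rows, the two orders of a pair carry the same product of entries and the same minor, with
  -- opposite signs.
  det-equal-heads : ∀ {n} (v : Vector Carrier (suc (suc n))) A → det (v ∷ v ∷ A) ≈ 0#
  det-equal-heads {n} v A = trans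
    (sum-cong-≋ λ j → *-distribˡ-sum (sign j * v j) (λ k → sign k * v (punchIn j k) * minor j k))
    (sum-cancel-pairs _ cancel)
    where
    minor : Fin (suc (suc n)) → Fin (suc n) → Carrier
    minor j k = det (λ i l → A i (punchIn j (punchIn k l)))
    cancel : ∀ j k → let j′ = punchIn j k ; k′ = pinch k j in
      sign j * v j * (sign k * v (punchIn j k) * minor j k) +
      sign j′ * v j′ * (sign k′ * v (punchIn j′ k′) * minor j′ k′) ≈ 0#
    cancel j k = begin
      sign j * v j * (sign k * v j′ * minor j k) + sign j′ * v j′ * (sign k′ * v (punchIn j′ k′) * minor j′ k′)
        ≈⟨ +-cong (regroup (sign j) (v j) (sign k) (v j′) (minor j k))
             (regroup (sign j′) (v j′) (sign k′) (v (punchIn j′ k′)) (minor j′ k′)) ⟩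
      sign j * sign k * (v j * v j′ * minor j k) +
      sign j′ * sign k′ * (v j′ * v (punchIn j′ k′) * minor j′ k′)
        ≈⟨ +-cong (*-congʳ (sign-exchange j k)) (*-congˡ (*-cong
             (trans (*-congˡ (reflexive (≡.cong v (punchIn-pinch j k)))) (*-comm _ _))
             (det-cong λ i l → reflexive (≡.cong (A i) (≡.sym (punchIn-exchange j k l)))))) ⟩
      - (sign j′ * sign k′) * (v j * v j′ * minor j k) +
      sign j′ * sign k′ * (v j * v j′ * minor j k)
        ≈⟨ distribʳ _ _ _ ⟨
      (- (sign j′ * sign k′) + sign j′ * sign k′) * (v j * v j′ * minor j k)
        ≈⟨ *-congʳ (-‿inverseˡ _) ⟩
      0# * (v j * v j′ * minor j k)
        ≈⟨ zeroˡ _ ⟩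
      0# ∎
      where
      j′ = punchIn j k
      k′ = pinch k j
      regroup : ∀ s a t b d → s * a * (t * b * d) ≈ s * t * (a * b * d)
      regroup = solve 5 (λ s a t b d → s :* a :* (t :* b :* d) := s :* t :* (a :* b :* d)) refl

  det-alternating : ∀ n → IsAlternating n (det {n})
  det-alternating zero    = tt
  det-alternating (suc n) = linear , vanishes n , λ v →
    alternating-sum (λ j → sign j * v j) (λ j A → det (λ i k → A i (punchIn j k))) λ j →
      alternating-∘ {φ = λ u k → u (punchIn j k)}
        (record { φ-cong = λ u≈v k → u≈v (punchIn j k) ; φ-linear = λ x y u v k → refl })
        det-cong (det-alternating n)
    where
    linear : ∀ x y u v A → det (combination x y u v ∷ A) ≈ x * det (u ∷ A) + y * det (v ∷ A)
    linear x y u v A = begin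
      sum (λ j → sign j * (x * u j + y * v j) * minor j)
        ≈⟨ sum-cong-≋ (λ j → solve 6
             (λ s x y a b d → s :* (x :* a :+ y :* b) :* d := x :* (s :* a :* d) :+ y :* (s :* b :* d)) refl
             (sign j) x y (u j) (v j) (minor j)) ⟩
      sum (λ j → x * (sign j * u j * minor j) + y * (sign j * v j * minor j))
        ≈⟨ sum-combination x y (λ j → sign j * u j * minor j) (λ j → sign j * v j * minor j) ⟩
      x * sum (λ j → sign j * u j * minor j) + y * sum (λ j → sign j * v j * minor j) ∎
      where
      minor : Fin (suc n) → Carrier
      minor j = det (λ i k → A i (punchIn j k))
    vanishes : ∀ n → VanishesOnEqualHeads n (det {suc n})
    vanishes zero    = tt
    vanishes (suc n) = det-equal-heads

  -- A right inverse of deleting column `j`. It restricts a form on rows of length n + 1 to rows of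
  -- length n, regarded as the rows with entry zero in column `j`.
  pad : Fin (suc n) → Vector Carrier n → Vector Carrier (suc n)
  pad j u = insertAt u j 0#

  pad-cong : ∀ (j : Fin (suc n)) {u v : Vector Carrier n} → (∀ k → u k ≈ v k) → ∀ k → pad j u k ≈ pad j v k
  pad-cong zero u≈v zero = refl
  pad-cong zero u≈v (suc k) = u≈v k
  pad-cong {suc n} (suc j) u≈v zero = u≈v zero
  pad-cong {suc n} (suc j) u≈v (suc k) = pad-cong j (u≈v ∘ suc) k

  pad-linear : ∀ (j : Fin (suc n)) x y u v k → pad j (combination x y u v) k ≈ combination x y (pad j u) (pad j v) k
  pad-linear zero x y u v zero = sym (trans (+-cong (zeroʳ x) (zeroʳ y)) (+-identityʳ 0#))
  pad-linear zero x y u v (suc k) = refl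
  pad-linear {suc n} (suc j) x y u v zero = refl
  pad-linear {suc n} (suc j) x y u v (suc k) = pad-linear j x y (u ∘ suc) (v ∘ suc) k

  identity-suc : ∀ (i j : Fin n) → identity (suc n) (suc i) (suc j) ≈ identity n i j
  identity-suc i j with i Fin.≟ j
  ... | yes _ = refl
  ... | no  _ = refl

  identity-zero : ∀ (i : Fin n) → identity (suc n) zero (suc i) ≈ 0#
  identity-zero {n} i = diagonal-≢ {suc n} (λ _ → 1#) {zero} {suc i} λ ()

  -- Clearing column `j` of a row subtracts a multiple of the unit vector at `j`, which is the shape
  -- of change that `shear` accepts.
  pad-remove : ∀ (j : Fin (suc n)) (v : Vector Carrier (suc n)) k →
               v k ≈ pad j (v ∘ punchIn j) k + v j * identity (suc n) j k
  pad-remove {n} zero v zero = sym (trans (+-identityˡ _) (*-identityʳ _))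
  pad-remove {n} zero v (suc k) = sym (trans (+-congˡ (trans (*-congˡ (identity-zero k)) (zeroʳ _))) (+-identityʳ _))
  pad-remove {suc n} (suc j) v zero = sym (trans (+-congˡ (zeroʳ _)) (+-identityʳ _))
  pad-remove {suc n} (suc j) v (suc k) = trans (pad-remove j (v ∘ suc) k) (+-congˡ (*-congˡ (sym (identity-suc j k))))

  pad-identity : ∀ (j : Fin (suc n)) i k → pad j (identity n i) k ≈ identity (suc n) (punchIn j i) k
  pad-identity zero i zero = refl
  pad-identity zero i (suc k) = sym (identity-suc i k)
  pad-identity (suc j) zero zero = refl
  pad-identity {suc n} (suc j) zero (suc k) = trans (pad-zero j k) (sym (identity-zero k))
    where
    pad-zero : ∀ {n} (j : Fin (suc n)) k → insertAt (λ i → identity (suc n) zero (suc i)) j 0# k ≈ 0#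
    pad-zero zero zero = refl
    pad-zero zero (suc k) = refl
    pad-zero {suc n} (suc j) zero = refl
    pad-zero {suc n} (suc j) (suc k) = trans (pad-cong j (λ i → refl) k) (pad-zero j k)
  pad-identity {suc n} (suc j) (suc i) zero = refl
  pad-identity {suc n} (suc j) (suc i) (suc k) =
    trans (pad-cong j (identity-suc i) k) (trans (pad-identity j i k) (sym (identity-suc (punchIn j i) k)))

  -- By linearity the first row may be taken to be a unit vector e. Shearing along e clears its
  -- column in the other rows, and what remains is an alternating form of the corresponding minor,
  -- known by induction up to its value at the smaller identity. That value is `f` at the identity
  -- with row `j` moved to the top, so the sign from `rotate` is the cofactor sign of the Laplace
  -- expansion.
  alternating-unique : ∀ {n} {f : Matrix n n → Carrier} → Congruent f → IsAlternating n f →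
                       ∀ A → f A ≈ det A * f (identity n)
  alternating-unique {zero}  {f} f-cong alt A = trans (f-cong λ ()) (sym (*-identityˡ _))
  alternating-unique {suc n} {f} f-cong alt A = begin
    f A
      ≈⟨ f-cong (λ { zero j → sym (trans (diagonalʳ (A zero) (λ _ → 1#) j) (*-identityʳ _)) ; (suc i) j → refl }) ⟩
    f ((λ k → sum (λ j → A zero j * identity (suc n) j k)) ∷ A ∘ suc)
      ≈⟨ head-sum f-cong alt (A zero) (identity (suc n)) (A ∘ suc) ⟩
    sum (λ j → A zero j * f (identity (suc n) j ∷ A ∘ suc))
      ≈⟨ sum-cong-≋ (λ j → trans (*-congˡ (expand j))
           (solve 4 (λ a d s t → a :* (d :* (s :* t)) := s :* a :* d :* t) refl
             (A zero j) (minor j) (sign j) (f (identity (suc n))))) ⟩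
    sum (λ j → sign j * A zero j * minor j * f (identity (suc n)))
      ≈⟨ *-distribʳ-sum (f (identity (suc n))) (λ j → sign j * A zero j * minor j) ⟨
    det A * f (identity (suc n)) ∎
    where
    minor : Fin (suc n) → Carrier
    minor j = det (λ i k → A (suc i) (punchIn j k))
    expand : ∀ j → f (identity (suc n) j ∷ A ∘ suc) ≈ minor j * (sign j * f (identity (suc n)))
    expand j = begin
      f (e ∷ A ∘ suc)
        ≈⟨ shear (section-cong {f = f} f-cong e) (proj₂ (proj₂ alt) e) e
             (λ B i Bi≈e → vanishes-on-repeated-head f-cong alt e B i Bi≈e)
             (A ∘ suc) (λ i → pad j (A (suc i) ∘ punchIn j)) (λ i → A (suc i) j) (λ i → pad-remove j (A (suc i))) ⟩
      f (e ∷ (λ i → pad j (A (suc i) ∘ punchIn j)))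
        ≈⟨ alternating-unique {f = λ B → f (e ∷ pad j ∘ B)}
             (λ B≋C → f-cong (∷-congˡ λ i → pad-cong j (B≋C i)))
             (alternating-∘ (record { φ-cong = pad-cong j ; φ-linear = pad-linear j })
               (section-cong {f = f} f-cong e) (proj₂ (proj₂ alt) e))
             (λ i k → A (suc i) (punchIn j k)) ⟩
      minor j * f (e ∷ pad j ∘ identity n)
        ≈⟨ *-congˡ (f-cong (∷-congˡ (pad-identity j))) ⟩
      minor j * f (identity (suc n) j ∷ identity (suc n) ∘ punchIn j)
        ≈⟨ *-congˡ (rotate f-cong alt (identity (suc n)) j) ⟩
      minor j * (sign j * f (identity (suc n))) ∎
      where
      e = identity (suc n) j

  det-identity : ∀ n → det (identity n) ≈ 1#
  det-identity zero    = refl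
  det-identity (suc n) = begin
    1# * 1# * det (λ i k → identity (suc n) (suc i) (suc k)) + sum (λ j → sign (suc j) * 0# * minor j)
      ≈⟨ +-cong (trans (*-cong (*-identityʳ 1#) (trans (det-cong {n} identity-suc) (det-identity n))) (*-identityʳ 1#))
                (sum-zero {n} λ j → trans (*-congʳ {minor j} (zeroʳ (sign (suc j)))) (zeroˡ (minor j))) ⟩
    1# + 0#
      ≈⟨ +-identityʳ 1# ⟩
    1# ∎
    where
    minor : Fin n → Carrier
    minor j = det (λ i k → identity (suc n) (suc i) (punchIn (suc j) k))

  -- For fixed `B` the left side is an alternating form in the rows of `A`, and its value at the
  -- identity is `det B`.
  det-* : ∀ {n} (A B : Matrix n n) → det (A ⊛ B) ≈ det A * det B
  det-* {n} A B = begin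
    det (A ⊛ B)                    ≈⟨ alternating-unique {f = λ A → det (A ⊛ B)} cong′ alternating A ⟩
    det A * det (identity n ⊛ B)   ≈⟨ *-congˡ (det-cong (identityˡ B)) ⟩
    det A * det B                  ∎
    where
    cong′ : Congruent (λ A → det (A ⊛ B))
    cong′ A≋A′ = det-cong λ i k → sum-cong-≋ λ j → *-congʳ (A≋A′ i j)
    alternating : IsAlternating n (λ A → det (A ⊛ B))
    alternating = alternating-∘ {φ = λ v k → sum (λ j → v j * B j k)}
      (record
        { φ-cong = λ u≈v k → sum-cong-≋ λ j → *-congʳ (u≈v j)
        ; φ-linear = λ x y u v k → begin
            sum (λ j → (x * u j + y * v j) * B j k)
              ≈⟨ sum-cong-≋ (λ j → solve 5 (λ x y a b d → (x :* a :+ y :* b) :* d := x :* (a :* d) :+ y :* (b :* d))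
                   refl x y (u j) (v j) (B j k)) ⟩
            sum (λ j → x * (u j * B j k) + y * (v j * B j k))
              ≈⟨ sum-combination x y (λ j → u j * B j k) (λ j → v j * B j k) ⟩
            x * sum (λ j → u j * B j k) + y * sum (λ j → v j * B j k) ∎ })
      det-cong (det-alternating n)

-- The rings of complex numbers and of polynomials

module _ {c ℓ} (R : CommutativeRing c ℓ) where
  open CommutativeRing R
  open RingProperties ring using (-1*x≈-x; -0#≈0#)
  open SemiringSolver commutativeSemiring using (solve; _:=_; _:+_; _:*_)
  open SetoidReasoning setoid

  complexRing : CommutativeRing c ℓ
  complexRing = record
    { Carrier = C.Carrier ; _≈_ = C._≈_ ; _+_ = C._+_ ; _*_ = C._*_ ; -_ = C.-_ ; 0# = C.0# ; 1# = C.1#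
    ; isCommutativeRing = record
      { isRing = record
        { +-isAbelianGroup = record
          { isGroup = record
            { isMonoid = record
              { isSemigroup = record
                { isMagma = record
                  { isEquivalence = record
                    { refl  = refl , refl
                    ; sym   = λ (p , q) → sym p , sym q
                    ; trans = λ (p , q) (p′ , q′) → trans p p′ , trans q q′ }
                  ; ∙-cong = λ (p , q) (p′ , q′) → +-cong p p′ , +-cong q q′ }
                ; assoc = λ (a , b) (a′ , b′) (a″ , b″) → +-assoc a a′ a″ , +-assoc b b′ b″ }
              ; identity = (λ (a , b) → +-identityˡ a , +-identityˡ b) , (λ (a , b) → +-identityʳ a , +-identityʳ b) }
            ; inverse = (λ (a , b) → -‿inverseˡ a , -‿inverseˡ b) , (λ (a , b) → -‿inverseʳ a , -‿inverseʳ b)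
            ; ⁻¹-cong = λ (p , q) → -‿cong p , -‿cong q }
          ; comm = λ (a , b) (a′ , b′) → +-comm a a′ , +-comm b b′ }
        ; *-cong = λ (p , q) (p′ , q′) →
            +-cong (*-cong p p′) (-‿cong (*-cong q q′)) , +-cong (*-cong p q′) (*-cong q p′)
        ; *-assoc = *-assoc-ℂ
        ; *-identity = *-identityˡ-ℂ , (λ x → transℂ (*-comm-ℂ x C.1#) (*-identityˡ-ℂ x))
        ; distrib = distribˡ-ℂ , (λ x y z → transℂ (*-comm-ℂ (y C.+ z) x)
            (transℂ (distribˡ-ℂ x y z) (+-congℂ (*-comm-ℂ x y) (*-comm-ℂ x z)))) }
      ; *-comm = *-comm-ℂ } }
    where
    module C = RawRing (complex rawRing)

    transℂ : ∀ {x y z} → x C.≈ y → y C.≈ z → x C.≈ z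
    transℂ (p , q) (p′ , q′) = trans p p′ , trans q q′

    +-congℂ : ∀ {x y u v} → x C.≈ y → u C.≈ v → (x C.+ u) C.≈ (y C.+ v)
    +-congℂ (p , q) (p′ , q′) = +-cong p p′ , +-cong q q′

    *-comm-ℂ : ∀ x y → (x C.* y) C.≈ (y C.* x)
    *-comm-ℂ (a , b) (a′ , b′) =
      +-cong (*-comm a a′) (-‿cong (*-comm b b′)) ,
      trans (+-comm _ _) (+-cong (*-comm b a′) (*-comm a b′))

    *-identityˡ-ℂ : ∀ x → (C.1# C.* x) C.≈ x
    *-identityˡ-ℂ (a , b) =
      trans (+-cong (*-identityˡ a) (trans (-‿cong (zeroˡ b)) -0#≈0#)) (+-identityʳ a) ,
      trans (+-cong (*-identityˡ b) (zeroˡ a)) (+-identityʳ b)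

    -- Writing - z as (- 1#) * z turns the real parts into semiring identities.
    minus : ∀ {w} z → w + - z ≈ w + - 1# * z
    minus z = +-congˡ (sym (-1*x≈-x z))

    *-assoc-ℂ : ∀ x y z → ((x C.* y) C.* z) C.≈ (x C.* (y C.* z))
    *-assoc-ℂ (a , b) (a′ , b′) (a″ , b″) =
      (begin
        (a * a′ + - (b * b′)) * a″ + - ((a * b′ + b * a′) * b″)
          ≈⟨ trans (+-congʳ (*-congʳ (minus _))) (minus _) ⟩
        (a * a′ + - 1# * (b * b′)) * a″ + - 1# * ((a * b′ + b * a′) * b″)
          ≈⟨ solve 7 (λ e a b a′ b′ a″ b″ →
               (a :* a′ :+ e :* (b :* b′)) :* a″ :+ e :* ((a :* b′ :+ b :* a′) :* b″) :=
               a :* (a′ :* a″ :+ e :* (b′ :* b″)) :+ e :* (b :* (a′ :* b″ :+ b′ :* a″)))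
               refl (- 1#) a b a′ b′ a″ b″ ⟩
        a * (a′ * a″ + - 1# * (b′ * b″)) + - 1# * (b * (a′ * b″ + b′ * a″))
          ≈⟨ trans (+-congʳ (*-congˡ (minus _))) (minus _) ⟨
        a * (a′ * a″ + - (b′ * b″)) + - (b * (a′ * b″ + b′ * a″)) ∎) ,
      (begin
        (a * a′ + - (b * b′)) * b″ + (a * b′ + b * a′) * a″
          ≈⟨ +-congʳ (*-congʳ (minus _)) ⟩
        (a * a′ + - 1# * (b * b′)) * b″ + (a * b′ + b * a′) * a″
          ≈⟨ solve 7 (λ e a b a′ b′ a″ b″ →
               (a :* a′ :+ e :* (b :* b′)) :* b″ :+ (a :* b′ :+ b :* a′) :* a″ :=
               a :* (a′ :* b″ :+ b′ :* a″) :+ b :* (a′ :* a″ :+ e :* (b′ :* b″)))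
               refl (- 1#) a b a′ b′ a″ b″ ⟩
        a * (a′ * b″ + b′ * a″) + b * (a′ * a″ + - 1# * (b′ * b″))
          ≈⟨ +-congˡ (*-congˡ (minus _)) ⟨
        a * (a′ * b″ + b′ * a″) + b * (a′ * a″ + - (b′ * b″)) ∎)

    distribˡ-ℂ : ∀ x y z → (x C.* (y C.+ z)) C.≈ ((x C.* y) C.+ (x C.* z))
    distribˡ-ℂ (a , b) (a′ , b′) (a″ , b″) =
      (begin
        a * (a′ + a″) + - (b * (b′ + b″))
          ≈⟨ minus _ ⟩
        a * (a′ + a″) + - 1# * (b * (b′ + b″))
          ≈⟨ solve 7 (λ e a b a′ b′ a″ b″ →
               a :* (a′ :+ a″) :+ e :* (b :* (b′ :+ b″)) :=
               (a :* a′ :+ e :* (b :* b′)) :+ (a :* a″ :+ e :* (b :* b″)))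
               refl (- 1#) a b a′ b′ a″ b″ ⟩
        (a * a′ + - 1# * (b * b′)) + (a * a″ + - 1# * (b * b″))
          ≈⟨ +-cong (minus _) (minus _) ⟨
        (a * a′ + - (b * b′)) + (a * a″ + - (b * b″)) ∎) ,
      solve 6 (λ a b a′ b′ a″ b″ →
        a :* (b′ :+ b″) :+ b :* (a′ :+ a″) := (a :* b′ :+ b :* a′) :+ (a :* b″ :+ b :* a″))
        refl a b a′ b′ a″ b″

module PolynomialProperties {c ℓ} (R : CommutativeRing c ℓ) where
  open import Data.List.Base using ([]; _∷_; map)
  open CommutativeRing R hiding (zero)
  open RingProperties ring using (-0#≈0#)
  open CommutativeSemigroupProperties +-commutativeSemigroup using (interchange; x∙yz≈y∙xz)
  open Polynomials rawRing
  open SetoidReasoning setoid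

  -- The Cauchy product ∑ f i · g (k - i), written by recursion on the left factor so that no
  -- subtraction of indices appears. Polynomials are compared by coefficients, so the ring laws are
  -- proved for sequences and carried over to lists by `coefficient-multiply`.
  convolution : (ℕ → Carrier) → (ℕ → Carrier) → ℕ → Carrier
  convolution f g zero    = f zero * g zero
  convolution f g (suc k) = f zero * g (suc k) + convolution (f ∘ suc) g k

  convolution-cong : ∀ {f f′ g g′} → (∀ k → f k ≈ f′ k) → (∀ k → g k ≈ g′ k) →
                     ∀ k → convolution f g k ≈ convolution f′ g′ k
  convolution-cong p q zero    = *-cong (p zero) (q zero)
  convolution-cong p q (suc k) = +-cong (*-cong (p zero) (q (suc k))) (convolution-cong (p ∘ suc) q k)

  convolution-zeroˡ : ∀ {f} g → (∀ k → f k ≈ 0#) → ∀ k → convolution f g k ≈ 0#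
  convolution-zeroˡ g p zero    = trans (*-congʳ (p zero)) (zeroˡ _)
  convolution-zeroˡ g p (suc k) =
    trans (+-cong (trans (*-congʳ (p zero)) (zeroˡ _)) (convolution-zeroˡ g (p ∘ suc) k)) (+-identityʳ 0#)

  convolution-distribʳ : ∀ f f′ g k →
    convolution (λ i → f i + f′ i) g k ≈ convolution f g k + convolution f′ g k
  convolution-distribʳ f f′ g zero    = distribʳ _ _ _
  convolution-distribʳ f f′ g (suc k) = trans
    (+-cong (distribʳ _ _ _) (convolution-distribʳ (f ∘ suc) (f′ ∘ suc) g k)) (interchange _ _ _ _)

  convolution-*ˡ : ∀ x f g k → convolution (λ i → x * f i) g k ≈ x * convolution f g k
  convolution-*ˡ x f g zero    = *-assoc x _ _
  convolution-*ˡ x f g (suc k) =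
    trans (+-cong (*-assoc x _ _) (convolution-*ˡ x (f ∘ suc) g k)) (sym (distribˡ x _ _))

  -- The definition peels off the first term of the left factor; peeling off that of the right
  -- factor is what closes the induction for commutativity.
  convolution-sucʳ : ∀ f g k → convolution f g (suc k) ≈ f (suc k) * g zero + convolution f (g ∘ suc) k
  convolution-sucʳ f g zero    = +-comm _ _
  convolution-sucʳ f g (suc k) = trans (+-congˡ (convolution-sucʳ (f ∘ suc) g k)) (x∙yz≈y∙xz _ _ _)

  convolution-comm : ∀ f g k → convolution f g k ≈ convolution g f k
  convolution-comm f g zero    = *-comm _ _
  convolution-comm f g (suc k) =
    trans (+-cong (*-comm _ _) (convolution-comm (f ∘ suc) g k)) (sym (convolution-sucʳ g f k))

  convolution-assoc : ∀ f g h k → convolution (convolution f g) h k ≈ convolution f (convolution g h) k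
  convolution-assoc f g h zero    = *-assoc _ _ _
  convolution-assoc f g h (suc k) = begin
    f zero * g zero * h (suc k) + convolution (λ i → f zero * g (suc i) + convolution (f ∘ suc) g i) h k
      ≈⟨ +-cong (*-assoc _ _ _) (convolution-distribʳ (λ i → f zero * g (suc i)) (convolution (f ∘ suc) g) h k) ⟩
    f zero * (g zero * h (suc k)) + (convolution (λ i → f zero * g (suc i)) h k + convolution (convolution (f ∘ suc) g) h k)
      ≈⟨ +-congˡ (+-cong (convolution-*ˡ (f zero) (g ∘ suc) h k) (convolution-assoc (f ∘ suc) g h k)) ⟩
    f zero * (g zero * h (suc k)) + (f zero * convolution (g ∘ suc) h k + convolution (f ∘ suc) (convolution g h) k)
      ≈⟨ +-assoc _ _ _ ⟨
    f zero * (g zero * h (suc k)) + f zero * convolution (g ∘ suc) h k + convolution (f ∘ suc) (convolution g h) k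
      ≈⟨ +-congʳ (distribˡ _ _ _) ⟨
    f zero * (g zero * h (suc k) + convolution (g ∘ suc) h k) + convolution (f ∘ suc) (convolution g h) k ∎

  coefficient-add : ∀ p q k → coefficient (add p q) k ≈ coefficient p k + coefficient q k
  coefficient-add []      q       k       = sym (+-identityˡ _)
  coefficient-add (a ∷ p) []      k       = sym (+-identityʳ _)
  coefficient-add (a ∷ p) (b ∷ q) zero    = refl
  coefficient-add (a ∷ p) (b ∷ q) (suc k) = coefficient-add p q k

  coefficient-scale : ∀ a q k → coefficient (map (a *_) q) k ≈ a * coefficient q k
  coefficient-scale a []      k       = sym (zeroʳ a)
  coefficient-scale a (b ∷ q) zero    = refl
  coefficient-scale a (b ∷ q) (suc k) = coefficient-scale a q k

  coefficient-neg : ∀ p k → coefficient (map -_ p) k ≈ - coefficient p k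
  coefficient-neg []      k       = sym -0#≈0#
  coefficient-neg (a ∷ p) zero    = refl
  coefficient-neg (a ∷ p) (suc k) = coefficient-neg p k

  coefficient-multiply : ∀ p q k → coefficient (multiply p q) k ≈ convolution (coefficient p) (coefficient q) k
  coefficient-multiply []      q k       = sym (convolution-zeroˡ (coefficient q) (λ _ → refl) k)
  coefficient-multiply (a ∷ p) q k       = trans (coefficient-add (map (a *_) q) (0# ∷ multiply p q) k) (go k)
    where
    go : ∀ k → coefficient (map (a *_) q) k + coefficient (0# ∷ multiply p q) k ≈
               convolution (coefficient (a ∷ p)) (coefficient q) k
    go zero    = trans (+-identityʳ _) (coefficient-scale a q zero)
    go (suc k) = +-cong (coefficient-scale a q (suc k)) (coefficient-multiply p q k)

  polynomialCommutativeRing : CommutativeRing c ℓ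
  polynomialCommutativeRing = record
    { Carrier = P.Carrier ; _≈_ = P._≈_ ; _+_ = P._+_ ; _*_ = P._*_ ; -_ = P.-_ ; 0# = P.0# ; 1# = P.1#
    ; isCommutativeRing = record
      { isRing = record
        { +-isAbelianGroup = record
          { isGroup = record
            { isMonoid = record
              { isSemigroup = record
                { isMagma = record
                  { isEquivalence = record
                    { refl  = λ k → refl
                    ; sym   = λ p k → sym (p k)
                    ; trans = λ p q k → trans (p k) (q k) }
                  ; ∙-cong = λ {p} {p′} {q} {q′} p≈ q≈ k → trans (coefficient-add p q k)
                      (trans (+-cong (p≈ k) (q≈ k)) (sym (coefficient-add p′ q′ k))) }
                ; assoc = λ p q r k → begin
                    coefficient (add (add p q) r) k
                      ≈⟨ trans (coefficient-add (add p q) r k) (+-congʳ (coefficient-add p q k)) ⟩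
                    coefficient p k + coefficient q k + coefficient r k
                      ≈⟨ +-assoc _ _ _ ⟩
                    coefficient p k + (coefficient q k + coefficient r k)
                      ≈⟨ trans (coefficient-add p (add q r) k) (+-congˡ (coefficient-add q r k)) ⟨
                    coefficient (add p (add q r)) k ∎ }
              ; identity = (λ p k → refl) , (λ p k → trans (coefficient-add p [] k) (+-identityʳ _)) }
            ; inverse =
                (λ p k → trans (coefficient-add (map -_ p) p k)
                   (trans (+-congʳ (coefficient-neg p k)) (-‿inverseˡ _))) ,
                (λ p k → trans (coefficient-add p (map -_ p) k)
                   (trans (+-congˡ (coefficient-neg p k)) (-‿inverseʳ _)))
            ; ⁻¹-cong = λ {p} {q} p≈q k → trans (coefficient-neg p k)
                (trans (-‿cong (p≈q k)) (sym (coefficient-neg q k))) }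
          ; comm = λ p q k → trans (coefficient-add p q k)
              (trans (+-comm _ _) (sym (coefficient-add q p k))) }
        ; *-cong = λ {p} {p′} {q} {q′} p≈ q≈ k → trans (coefficient-multiply p q k)
            (trans (convolution-cong p≈ q≈ k) (sym (coefficient-multiply p′ q′ k)))
        ; *-assoc = λ p q r k → begin
            coefficient (multiply (multiply p q) r) k
              ≈⟨ trans (coefficient-multiply (multiply p q) r k)
                   (convolution-cong (coefficient-multiply p q) (λ _ → refl) k) ⟩
            convolution (convolution (coefficient p) (coefficient q)) (coefficient r) k
              ≈⟨ convolution-assoc (coefficient p) (coefficient q) (coefficient r) k ⟩
            convolution (coefficient p) (convolution (coefficient q) (coefficient r)) k
              ≈⟨ trans (coefficient-multiply p (multiply q r) k)
                   (convolution-cong {coefficient p} (λ _ → refl) (coefficient-multiply q r) k) ⟨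
            coefficient (multiply p (multiply q r)) k ∎
        ; *-identity = multiply-identityˡ , (λ p k → trans (multiply-comm p P.1# k) (multiply-identityˡ p k))
        ; distrib = (λ p q r k → begin
              coefficient (multiply p (add q r)) k
                ≈⟨ multiply-comm p (add q r) k ⟩
              coefficient (multiply (add q r) p) k
                ≈⟨ multiply-distribʳ p q r k ⟩
              coefficient (add (multiply q p) (multiply r p)) k
                ≈⟨ coefficient-add (multiply q p) (multiply r p) k ⟩
              coefficient (multiply q p) k + coefficient (multiply r p) k
                ≈⟨ +-cong (multiply-comm q p k) (multiply-comm r p k) ⟩
              coefficient (multiply p q) k + coefficient (multiply p r) k
                ≈⟨ coefficient-add (multiply p q) (multiply p r) k ⟨
              coefficient (add (multiply p q) (multiply p r)) k ∎) ,
            multiply-distribʳ }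
      ; *-comm = multiply-comm } }
    where
    module P = RawRing polynomialRing

    multiply-comm : ∀ p q → multiply p q P.≈ multiply q p
    multiply-comm p q k = trans (coefficient-multiply p q k)
      (trans (convolution-comm (coefficient p) (coefficient q) k) (sym (coefficient-multiply q p k)))

    multiply-identityˡ : ∀ p → multiply P.1# p P.≈ p
    multiply-identityˡ p k = trans (coefficient-multiply P.1# p k) (go k)
      where
      go : ∀ k → convolution (coefficient P.1#) (coefficient p) k ≈ coefficient p k
      go zero    = *-identityˡ _
      go (suc k) = trans
        (+-cong (*-identityˡ _) (convolution-zeroˡ (coefficient p) (λ _ → refl) k)) (+-identityʳ _)

    multiply-distribʳ : ∀ r p q → multiply (add p q) r P.≈ add (multiply p r) (multiply q r)
    multiply-distribʳ r p q k = begin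
      coefficient (multiply (add p q) r) k
        ≈⟨ trans (coefficient-multiply (add p q) r k) (convolution-cong (coefficient-add p q) (λ _ → refl) k) ⟩
      convolution (λ i → coefficient p i + coefficient q i) (coefficient r) k
        ≈⟨ convolution-distribʳ (coefficient p) (coefficient q) (coefficient r) k ⟩
      convolution (coefficient p) (coefficient r) k + convolution (coefficient q) (coefficient r) k
        ≈⟨ +-cong (coefficient-multiply p r k) (coefficient-multiply q r k) ⟨
      coefficient (multiply p r) k + coefficient (multiply q r) k
        ≈⟨ coefficient-add (multiply p r) (multiply q r) k ⟨
      coefficient (add (multiply p r) (multiply q r)) k ∎

-- Similar matrices

module Similarity {c ℓ} (R : CommutativeRing c ℓ) where
  open CommutativeRing R hiding (zero)
  open Matrices rawRing
  open MatrixProperties R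
  open Determinant R using (det-cong; det-*; det-identity)
  open RingProperties ring using (-‿distribˡ-*; -‿distribʳ-*; -1*x≈-x)
  open SetoidReasoning setoid

  -- The sizes `m` and `n` may be different expressions, so `P` is formally rectangular, and both
  -- inverse laws are required instead of deriving one from the other.
  record Similar {m n} (A : Matrix m m) (B : Matrix n n) : Set (c ⊔ ℓ) where
    field
      P           : Matrix m n
      Q           : Matrix n m
      PQ≈1        : ∀ i j → (P ⊛ Q) i j ≈ identity m i j
      QP≈1        : ∀ i j → (Q ⊛ P) i j ≈ identity n i j
      intertwines : ∀ i j → (A ⊛ P) i j ≈ (P ⊛ B) i j

  similar-sym : ∀ {m n} {A : Matrix m m} {B : Matrix n n} → Similar A B → Similar B A
  similar-sym {m} {n} {A} {B} S = record
    { P = Q ; Q = P ; PQ≈1 = QP≈1 ; QP≈1 = PQ≈1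
    ; intertwines = λ i j → begin
        (B ⊛ Q) i j              ≈⟨ identityˡ (B ⊛ Q) i j ⟨
        (identity n ⊛ (B ⊛ Q)) i j  ≈⟨ sum-cong-≋ (λ k → *-congʳ {(B ⊛ Q) k j} (QP≈1 i k)) ⟨
        ((Q ⊛ P) ⊛ (B ⊛ Q)) i j  ≈⟨ ⊛-assoc Q P (B ⊛ Q) i j ⟩
        (Q ⊛ (P ⊛ (B ⊛ Q))) i j  ≈⟨ sum-cong-≋ (λ k → *-congˡ {Q i k} (⊛-assoc P B Q k j)) ⟨
        (Q ⊛ ((P ⊛ B) ⊛ Q)) i j  ≈⟨ sum-cong-≋ (λ k → *-congˡ {Q i k} (sum-cong-≋ λ l → *-congʳ {Q l j} (intertwines k l))) ⟨
        (Q ⊛ ((A ⊛ P) ⊛ Q)) i j  ≈⟨ sum-cong-≋ (λ k → *-congˡ {Q i k} (⊛-assoc A P Q k j)) ⟩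
        (Q ⊛ (A ⊛ (P ⊛ Q))) i j  ≈⟨ sum-cong-≋ (λ k → *-congˡ {Q i k} (sum-cong-≋ λ l → *-congˡ {A k l} (PQ≈1 l j))) ⟩
        (Q ⊛ (A ⊛ identity m)) i j  ≈⟨ sum-cong-≋ (λ k → *-congˡ {Q i k} (identityʳ A k j)) ⟩
        (Q ⊛ A) i j              ∎ }
    where open Similar S

  -- A scalar matrix commutes with any change of basis. Used with x = 1 to pass to Laplacians, and
  -- with x the indeterminate `X` to pass to characteristic matrices.
  similar-⊖ : ∀ {m n} {A : Matrix m m} {B : Matrix n n} x → Similar A B →
              Similar (diagonal (λ _ → x) ⊖ A) (diagonal (λ _ → x) ⊖ B)
  similar-⊖ {m} {n} {A} {B} x S = record { P = P ; Q = Q ; PQ≈1 = PQ≈1 ; QP≈1 = QP≈1 ; intertwines = commute }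
    where
    open Similar S
    Dₘ : Matrix m m
    Dₘ = diagonal (λ _ → x)
    Dₙ : Matrix n n
    Dₙ = diagonal (λ _ → x)
    minus-*ˡ : ∀ d a p → (d + - a) * p ≈ d * p + - 1# * (a * p)
    minus-*ˡ d a p = trans (distribʳ p d (- a)) (+-congˡ (trans (sym (-‿distribˡ-* a p)) (sym (-1*x≈-x (a * p)))))
    minus-*ʳ : ∀ p d a → p * (d + - a) ≈ p * d + - 1# * (p * a)
    minus-*ʳ p d a = trans (distribˡ p d (- a)) (+-congˡ (trans (sym (-‿distribʳ-* p a)) (sym (-1*x≈-x (p * a)))))
    commute : ∀ i j → ((Dₘ ⊖ A) ⊛ P) i j ≈ (P ⊛ (Dₙ ⊖ B)) i j
    commute i k = begin
      sum (λ j → (Dₘ i j + - A i j) * P j k)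
        ≈⟨ sum-cong-≋ (λ j → minus-*ˡ (Dₘ i j) (A i j) (P j k)) ⟩
      sum (λ j → Dₘ i j * P j k + - 1# * (A i j * P j k))
        ≈⟨ ∑-distrib-+ (λ j → Dₘ i j * P j k) (λ j → - 1# * (A i j * P j k)) ⟩
      sum (λ j → Dₘ i j * P j k) + sum (λ j → - 1# * (A i j * P j k))
        ≈⟨ +-cong (diagonalˡ (λ _ → x) (λ j → P j k) i) (sym (*-distribˡ-sum (- 1#) (λ j → A i j * P j k))) ⟩
      x * P i k + - 1# * (A ⊛ P) i k
        ≈⟨ +-cong (*-comm _ _) (*-congˡ (intertwines i k)) ⟩
      P i k * x + - 1# * (P ⊛ B) i k
        ≈⟨ +-cong (sym (diagonalʳ (P i) (λ _ → x) k)) (*-distribˡ-sum (- 1#) (λ j → P i j * B j k)) ⟩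
      sum (λ j → P i j * Dₙ j k) + sum (λ j → - 1# * (P i j * B j k))
        ≈⟨ ∑-distrib-+ (λ j → P i j * Dₙ j k) (λ j → - 1# * (P i j * B j k)) ⟨
      sum (λ j → P i j * Dₙ j k + - 1# * (P i j * B j k))
        ≈⟨ sum-cong-≋ (λ j → minus-*ʳ (P i j) (Dₙ j k) (B j k)) ⟨
      sum (λ j → P i j * (Dₙ j k + - B j k)) ∎

  similar-resp : ∀ {m n} {A A′ : Matrix m m} {B B′ : Matrix n n} → (∀ i j → A i j ≈ A′ i j) →
                 (∀ i j → B i j ≈ B′ i j) → Similar A B → Similar A′ B′
  similar-resp A≈A′ B≈B′ S = record
    { P = P ; Q = Q ; PQ≈1 = PQ≈1 ; QP≈1 = QP≈1
    ; intertwines = λ i j → trans (sum-cong-≋ λ k → *-congʳ {P k j} (sym (A≈A′ i k)))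
        (trans (intertwines i j) (sum-cong-≋ λ k → *-congˡ {P i k} (B≈B′ k j))) }
    where open Similar S

  det-similar : ∀ {n} {A B : Matrix n n} → Similar A B → det A ≈ det B
  det-similar {n} {A} {B} S = begin
    det A                     ≈⟨ *-identityʳ _ ⟨
    det A * 1#                ≈⟨ *-congˡ detP*detQ ⟨
    det A * (det P * det Q)   ≈⟨ *-assoc _ _ _ ⟨
    det A * det P * det Q     ≈⟨ *-congʳ (det-* A P) ⟨
    det (A ⊛ P) * det Q       ≈⟨ *-congʳ (det-cong intertwines) ⟩
    det (P ⊛ B) * det Q       ≈⟨ *-congʳ (trans (det-* P B) (*-comm _ _)) ⟩
    det B * det P * det Q     ≈⟨ *-assoc _ _ _ ⟩
    det B * (det P * det Q)   ≈⟨ *-congˡ detP*detQ ⟩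
    det B * 1#                ≈⟨ *-identityʳ _ ⟩
    det B                     ∎
    where
    open Similar S
    detP*detQ : det P * det Q ≈ 1#
    detP*detQ = trans (sym (det-* P Q)) (trans (det-cong PQ≈1) (det-identity n))

-- Transport of similarity along homomorphisms.

module _ {c ℓ c′ ℓ′} (R : CommutativeRing c ℓ) (R′ : CommutativeRing c′ ℓ′)
         {h : CommutativeRing.Carrier R → CommutativeRing.Carrier R′}
         (hom : IsSemiringHomomorphism (RawRing.rawSemiring (CommutativeRing.rawRing R))
                                       (RawRing.rawSemiring (CommutativeRing.rawRing R′)) h) where
  open IsSemiringHomomorphism hom
  open CommutativeRing R′ hiding (zero)
  private
    module R  = CommutativeRing R
    module M  = Matrices R.rawRing
    module M′ = Matrices rawRing
    module MP  = MatrixProperties R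
    module MP′ = MatrixProperties R′

  sum-homo : ∀ {n} (f : Vector R.Carrier n) → h (MP.sum f) ≈ MP′.sum (h ∘ f)
  sum-homo {zero}  f = 0#-homo
  sum-homo {suc n} f = trans (+-homo _ _) (+-congˡ (sum-homo (f ∘ suc)))

  ⊛-homo : ∀ {l m n} (A : M.Matrix l m) (B : M.Matrix m n) i k →
           h ((A M.⊛ B) i k) ≈ ((λ i j → h (A i j)) M′.⊛ (λ i j → h (B i j))) i k
  ⊛-homo A B i k = trans (sum-homo (λ j → A i j R.* B j k)) (MP′.sum-cong-≋ λ j → *-homo (A i j) (B j k))

  identity-homo : ∀ n i j → h (M.identity n i j) ≈ M′.identity n i j
  identity-homo n i j with i Fin.≟ j
  ... | yes _ = 1#-homo
  ... | no  _ = 0#-homo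

  -- The equations of a similarity involve only sums, products, 0 and 1, hence semiring
  -- homomorphisms suffice. The chain used is from the reals to ℂ and from ℂ to ℂ[X].
  similar-homo : ∀ {m n} {A : M.Matrix m m} {B : M.Matrix n n} → Similarity.Similar R A B →
                 Similarity.Similar R′ (λ i j → h (A i j)) (λ i j → h (B i j))
  similar-homo {m} {n} {A} {B} S = record
    { P = λ i j → h (P i j)
    ; Q = λ i j → h (Q i j)
    ; PQ≈1 = λ i j → trans (sym (⊛-homo P Q i j)) (trans (⟦⟧-cong (PQ≈1 i j)) (identity-homo m i j))
    ; QP≈1 = λ i j → trans (sym (⊛-homo Q P i j)) (trans (⟦⟧-cong (QP≈1 i j)) (identity-homo n i j))
    ; intertwines = λ i j → trans (sym (⊛-homo A P i j)) (trans (⟦⟧-cong (intertwines i j)) (⊛-homo P B i j))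
    }
    where open Similarity.Similar S

module _ {c ℓ} (R : CommutativeRing c ℓ) where
  open CommutativeRing R hiding (zero)
  open RingProperties ring using (-0#≈0#)
  open Polynomials rawRing using (polynomialRing; constant)

  constant-homo : IsSemiringHomomorphism (RawRing.rawSemiring rawRing)
                    (RawRing.rawSemiring polynomialRing) constant
  constant-homo = record
    { isNearSemiringHomomorphism = record
      { +-isMonoidHomomorphism = record
        { isMagmaHomomorphism = record
          { isRelHomomorphism = record { cong = λ { x≈y zero → x≈y ; x≈y (suc k) → refl } }
          ; homo = λ x y k → refl }
        ; ε-homo = λ { zero → refl ; (suc k) → refl } }
      ; *-homo = λ { x y zero → sym (+-identityʳ _) ; x y (suc k) → refl } }
    ; 1#-homo = λ k → refl }

  real-homo : IsSemiringHomomorphism (RawRing.rawSemiring rawRing)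
                (RawRing.rawSemiring (complex rawRing)) (_, 0#)
  real-homo = record
    { isNearSemiringHomomorphism = record
      { +-isMonoidHomomorphism = record
        { isMagmaHomomorphism = record
          { isRelHomomorphism = record { cong = λ x≈y → x≈y , refl }
          ; homo = λ x y → refl , sym (+-identityʳ 0#) }
        ; ε-homo = refl , refl }
      ; *-homo = λ x y →
          sym (trans (+-congˡ (trans (-‿cong (zeroˡ 0#)) -0#≈0#)) (+-identityʳ _)) ,
          sym (trans (+-cong (zeroʳ x) (zeroˡ y)) (+-identityʳ 0#)) }
    ; 1#-homo = refl , refl }

-- Eigenvalues and multiplicities of similar matrices.

module _ {c ℓ} (R : CommutativeRing c ℓ) where
  open CommutativeRing R hiding (zero)
  open Matrices rawRing
  open MatrixProperties R
  open Similarity R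
  open Spectrum rawRing
  open Polynomials rawRing
  open PolynomialProperties R using (polynomialCommutativeRing)
  open SetoidReasoning setoid
  private
    module Poly = CommutativeRing polynomialCommutativeRing
    open MagmaDivisibility Poly.*-magma using (∣ʳ-respʳ-≈)

  -- The similarity is moved to constant matrices over ℂ[X], or over R[X] in general, and shifted by
  -- `X`. The equality of sizes makes `P` and `Q` square, so that they have determinants.
  characteristicPolynomial-similar : ∀ {m n} → m ≡ n → {A : Matrix m m} {B : Matrix n n} → Similar A B →
    characteristicPolynomial A Poly.≈ characteristicPolynomial B
  characteristicPolynomial-similar ≡.refl S =
    P.det-similar (P.similar-⊖ X (similar-homo R polynomialCommutativeRing (constant-homo R) S))
    where module P = Similarity polynomialCommutativeRing

  -- `Q` carries eigenvectors of `A` to eigenvectors of `B`, and it kills none of them because v = P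
  -- (Q v).
  eigenvalue-similar : ∀ {m n} {A : Matrix m m} {B : Matrix n n} → Similar A B →
                       ∀ {μ} → IsEigenvalue A μ → IsEigenvalue B μ
  eigenvalue-similar {m} {n} {A} {B} S {μ} (v , v≉0 , Av≈μv) =
    (λ i → (Q ⊛ V) i zero) ,
    (λ Qv≈0 → v≉0 λ i → begin
      v i                          ≈⟨ identityˡ V i zero ⟨
      (identity m ⊛ V) i zero      ≈⟨ sum-cong-≋ (λ k → *-congʳ {V k zero} (PQ≈1 i k)) ⟨
      ((P ⊛ Q) ⊛ V) i zero         ≈⟨ ⊛-assoc P Q V i zero ⟩
      (P ⊛ (Q ⊛ V)) i zero         ≈⟨ sum-zero (λ k → trans (*-congˡ (Qv≈0 k)) (zeroʳ (P i k))) ⟩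
      0#                           ∎) ,
    λ i → begin
      (B ⊛ (Q ⊛ V)) i zero         ≈⟨ ⊛-assoc B Q V i zero ⟨
      ((B ⊛ Q) ⊛ V) i zero         ≈⟨ sum-cong-≋ (λ k → *-congʳ {V k zero} (Similar.intertwines (similar-sym S) i k)) ⟩
      ((Q ⊛ A) ⊛ V) i zero         ≈⟨ ⊛-assoc Q A V i zero ⟩
      (Q ⊛ (A ⊛ V)) i zero         ≈⟨ sum-cong-≋ (λ k → trans (*-congˡ (Av≈μv k)) (x∙yz≈y∙xz (Q i k) μ (v k))) ⟩
      sum (λ k → μ * (Q i k * v k)) ≈⟨ *-distribˡ-sum μ (λ k → Q i k * v k) ⟨
      μ * (Q ⊛ V) i zero           ∎
    where
    open Similar S
    open CommutativeSemigroupProperties *-commutativeSemigroup using (x∙yz≈y∙xz)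
    V : Matrix m 1
    V i _ = v i

  multiplicity-cong : ∀ {m n} (A : Matrix m m) (B : Matrix n n) →
    characteristicPolynomial A Poly.≈ characteristicPolynomial B →
    ∀ μ k → HasMultiplicity A μ k → HasMultiplicity B μ k
  multiplicity-cong A B A≈B μ k (div , ¬div) =
    ∣ʳ-respʳ-≈ {_} {χA} {χB} A≈B div ,
    λ div′ → ¬div (∣ʳ-respʳ-≈ {_} {χB} {χA} (Poly.sym {χA} {χB} A≈B) div′)
    where
    χA = characteristicPolynomial A
    χB = characteristicPolynomial B

  sameSpectrum-similar : ∀ {m n} → m ≡ n → {A : Matrix m m} {B : Matrix n n} → Similar A B → SameSpectrum A B
  sameSpectrum-similar m≡n {A} {B} S μ =
    mk⇔ (eigenvalue-similar S) (eigenvalue-similar (similar-sym S)) ,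
    λ k → mk⇔ (multiplicity-cong A B (characteristicPolynomial-similar m≡n S) μ k)
              (multiplicity-cong B A (characteristicPolynomial-similar (≡.sym m≡n) (similar-sym S)) μ k)

-- Block matrices and linear maps

↑-elim : ∀ {a m n} (P : Fin (m ℕ.+ n) → Set a) → (∀ i → P (i ↑ˡ n)) → (∀ j → P (m ↑ʳ j)) → ∀ k → P k
↑-elim {m = m} {n} P left right k = ≡.subst P (Fin.join-splitAt m n k) (go (splitAt m k))
  where
  go : ∀ s → P ([ _↑ˡ n , m ↑ʳ_ ]′ s)
  go (inj₁ i) = left i
  go (inj₂ j) = right j

combine-elim : ∀ {a m n} (P : Fin (m ℕ.* n) → Set a) → (∀ i j → P (combine i j)) → ∀ k → P k
combine-elim {m = m} {n} P each k with Fin.combine-surjective {m} {n} k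
... | i , j , ≡.refl = each i j

module SumProperties {c ℓ} (R : CommutativeRing c ℓ) where
  open CommutativeRing R hiding (zero)
  open MatrixProperties R
  open Matrices rawRing
  open SetoidReasoning setoid

  sum-↑ : ∀ {m n} (f : Vector Carrier (m ℕ.+ n)) → sum f ≈ sum (λ i → f (i ↑ˡ n)) + sum (λ j → f (m ↑ʳ j))
  sum-↑ {zero}  f = sym (+-identityˡ _)
  sum-↑ {suc m} f = trans (+-congˡ (sum-↑ {m} (f ∘ suc))) (sym (+-assoc _ _ _))

  sum-combine : ∀ {m n} (f : Vector Carrier (m ℕ.* n)) →
                sum f ≈ sum (λ i → sum (λ j → f (combine {m} {n} i j)))
  sum-combine {zero}      f = refl
  sum-combine {suc m} {n} f = trans (sum-↑ {n} {m ℕ.* n} f) (+-congˡ (sum-combine {m} {n} (f ∘ (n ↑ʳ_))))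

  -- The number n enters the ring as a sum of n ones, the form in which it arises when a constant is
  -- summed over the n copies.
  IsReciprocal : ℕ → Carrier → Set ℓ
  IsReciprocal n ι = sum {n} (λ _ → 1#) * ι ≈ 1#

  sum-const : ∀ n a → sum {n} (λ _ → a) ≈ sum {n} (λ _ → 1#) * a
  sum-const n a = trans (sum-cong-≋ {n} λ _ → sym (*-identityˡ a)) (sym (*-distribʳ-sum {n} a (λ _ → 1#)))

  module _ {m m′ n n′} (A : Matrix m n) (B : Matrix m n′) (C : Matrix m′ n) (D : Matrix m′ n′) where

    block-ˡˡ : ∀ i j → block A B C D (i ↑ˡ m′) (j ↑ˡ n′) ≡ A i j
    block-ˡˡ i j rewrite Fin.splitAt-↑ˡ m i m′ | Fin.splitAt-↑ˡ n j n′ = ≡.refl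

    block-ˡʳ : ∀ i j → block A B C D (i ↑ˡ m′) (n ↑ʳ j) ≡ B i j
    block-ˡʳ i j rewrite Fin.splitAt-↑ˡ m i m′ | Fin.splitAt-↑ʳ n n′ j = ≡.refl

    block-ʳˡ : ∀ i j → block A B C D (m ↑ʳ i) (j ↑ˡ n′) ≡ C i j
    block-ʳˡ i j rewrite Fin.splitAt-↑ʳ m m′ i | Fin.splitAt-↑ˡ n j n′ = ≡.refl

    block-ʳʳ : ∀ i j → block A B C D (m ↑ʳ i) (n ↑ʳ j) ≡ D i j
    block-ʳʳ i j rewrite Fin.splitAt-↑ʳ m m′ i | Fin.splitAt-↑ʳ n n′ j = ≡.refl

  rowOfCopies-combine : ∀ k {m n} (A : Matrix m n) i l j → rowOfCopies k A i (combine {k} l j) ≡ A i j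
  rowOfCopies-combine k A i l j = ≡.cong (A i ∘ proj₂) (Fin.remQuot-combine {k} l j)

  columnOfCopies-combine : ∀ k {m n} (A : Matrix m n) l i j → columnOfCopies k A (combine {k} l i) j ≡ A i j
  columnOfCopies-combine k A l i j = ≡.cong (λ e → A (proj₂ e) j) (Fin.remQuot-combine {k} l i)

  module _ {m m′ n n′} (A : Matrix m n) (B : Matrix m n′) (C : Matrix m′ n) (D : Matrix m′ n′)
           (v : Vector Carrier (n ℕ.+ n′)) where

    block-*-ˡ : ∀ i → sum (λ j → block A B C D (i ↑ˡ m′) j * v j) ≈
                sum (λ j → A i j * v (j ↑ˡ n′)) + sum (λ j → B i j * v (n ↑ʳ j))
    block-*-ˡ i = trans (sum-↑ {n} (λ j → block A B C D (i ↑ˡ m′) j * v j))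
      (+-cong (sum-cong-≋ {n} λ j → *-congʳ (reflexive (block-ˡˡ A B C D i j)))
              (sum-cong-≋ {n′} λ j → *-congʳ (reflexive (block-ˡʳ A B C D i j))))

    block-*-ʳ : ∀ i → sum (λ j → block A B C D (m ↑ʳ i) j * v j) ≈
                sum (λ j → C i j * v (j ↑ˡ n′)) + sum (λ j → D i j * v (n ↑ʳ j))
    block-*-ʳ i = trans (sum-↑ {n} (λ j → block A B C D (m ↑ʳ i) j * v j))
      (+-cong (sum-cong-≋ {n} λ j → *-congʳ (reflexive (block-ʳˡ A B C D i j)))
              (sum-cong-≋ {n′} λ j → *-congʳ (reflexive (block-ʳʳ A B C D i j))))

  zeros-* : ∀ {n} (v : Vector Carrier n) → sum (λ j → 0# * v j) ≈ 0#
  zeros-* v = sum-zero λ j → zeroˡ (v j)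

  ⊕-zeros-*-ˡ : ∀ {m k} (A : Matrix m m) (v : Vector Carrier (m ℕ.+ k)) i →
    sum (λ j → (A ⊕ zeros k k) (i ↑ˡ k) j * v j) ≈ sum (λ j → A i j * v (j ↑ˡ k))
  ⊕-zeros-*-ˡ {m} {k} A v i = trans (block-*-ˡ A (zeros m k) (zeros k m) (zeros k k) v i)
    (trans (+-congˡ (zeros-* {k} λ j → v (m ↑ʳ j))) (+-identityʳ _))

  ⊕-zeros-*-ʳ : ∀ {m k} (A : Matrix m m) (v : Vector Carrier (m ℕ.+ k)) i →
    sum (λ j → (A ⊕ zeros k k) (m ↑ʳ i) j * v j) ≈ 0#
  ⊕-zeros-*-ʳ {m} {k} A v i = trans (block-*-ʳ A (zeros m k) (zeros k m) (zeros k k) v i)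
    (trans (+-cong (zeros-* {m} λ j → v (j ↑ˡ k)) (zeros-* {k} λ j → v (m ↑ʳ j))) (+-identityʳ 0#))

  rowOfCopies-* : ∀ k {m n} (A : Matrix m n) (v : Vector Carrier (k ℕ.* n)) i →
    sum (λ e → rowOfCopies k A i e * v e) ≈ sum (λ l → sum (λ j → A i j * v (combine {k} l j)))
  rowOfCopies-* k {n = n} A v i = trans (sum-combine {k} {n} (λ e → rowOfCopies k A i e * v e))
    (sum-cong-≋ {k} λ l → sum-cong-≋ {n} λ j → *-congʳ (reflexive (rowOfCopies-combine k A i l j)))

  columnOfCopies-* : ∀ k {m n} (A : Matrix m n) (v : Vector Carrier n) l i →
    sum (λ j → columnOfCopies k A (combine {k} l i) j * v j) ≈ sum (λ j → A i j * v j)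
  columnOfCopies-* k {n = n} A v l i = sum-cong-≋ {n} λ j → *-congʳ (reflexive (columnOfCopies-combine k A l i j))

-- Similarity from mutually inverse linear maps.

module LinearMaps {c ℓ} (R : CommutativeRing c ℓ) where
  open CommutativeRing R hiding (zero)
  open Matrices rawRing
  open MatrixProperties R
  open Determinant R using (combination; IsLinearMap)
  open Similarity R
  open SetoidReasoning setoid

  linear-sum : ∀ {m n} {φ : Vector Carrier m → Vector Carrier n} → IsLinearMap φ →
    ∀ {k} (a : Vector Carrier k) (v : Fin k → Vector Carrier m) i →
    φ (λ l → sum (λ j → a j * v j l)) i ≈ sum (λ j → a j * φ (v j) i)
  linear-sum {m} {n} {φ} lin {zero} a v i = begin
    φ (λ _ → 0#) i                                ≈⟨ φ-cong (λ l → trans (+-cong (zeroˡ 0#) (zeroˡ 0#)) (+-identityʳ 0#)) i ⟨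
    φ (combination 0# 0# (λ _ → 0#) (λ _ → 0#)) i  ≈⟨ φ-linear 0# 0# (λ _ → 0#) (λ _ → 0#) i ⟩
    0# * _ + 0# * _                               ≈⟨ trans (+-cong (zeroˡ _) (zeroˡ _)) (+-identityʳ 0#) ⟩
    0#                                            ∎
    where open IsLinearMap lin
  linear-sum {m} {n} {φ} lin {suc k} a v i = begin
    φ (λ l → a zero * v zero l + sum (λ j → a (suc j) * v (suc j) l)) i
      ≈⟨ φ-cong (λ l → +-congˡ (*-identityˡ _)) i ⟨
    φ (combination (a zero) 1# (v zero) w) i
      ≈⟨ φ-linear (a zero) 1# (v zero) w i ⟩
    a zero * φ (v zero) i + 1# * φ w i
      ≈⟨ +-congˡ (trans (*-identityˡ _) (linear-sum lin (a ∘ suc) (v ∘ suc) i)) ⟩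
    a zero * φ (v zero) i + sum (λ j → a (suc j) * φ (v (suc j)) i) ∎
    where
    open IsLinearMap lin
    w : Vector Carrier m
    w l = sum (λ j → a (suc j) * v (suc j) l)

  -- Allows the change of basis to be given on vectors, where its blocks have short formulas. The
  -- matrices have the images of the unit vectors as columns; the one of `φ` gives B P = P A, hence
  -- the final `similar-sym`.
  similar-linear : ∀ {m n} {A : Matrix m m} {B : Matrix n n}
    {φ : Vector Carrier m → Vector Carrier n} {ψ : Vector Carrier n → Vector Carrier m} →
    IsLinearMap φ → IsLinearMap ψ → (∀ v i → ψ (φ v) i ≈ v i) → (∀ v i → φ (ψ v) i ≈ v i) →
    (∀ v i → φ (λ k → sum (λ j → A k j * v j)) i ≈ sum (λ j → B i j * φ v j)) → Similar A B
  similar-linear {m} {n} {A} {B} {φ} {ψ} lin-φ lin-ψ ψφ φψ φA≈Bφ = similar-sym (record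
    { P = P
    ; Q = Q
    ; PQ≈1 = λ i j → begin
        sum (λ k → φ (e k) i * ψ (e j) k)      ≈⟨ apply lin-φ (ψ (e j)) i ⟩
        φ (ψ (e j)) i                          ≈⟨ φψ (e j) i ⟩
        identity n i j                         ∎
    ; QP≈1 = λ i j → begin
        sum (λ k → ψ (e k) i * φ (e j) k)      ≈⟨ apply lin-ψ (φ (e j)) i ⟩
        ψ (φ (e j)) i                          ≈⟨ ψφ (e j) i ⟩
        identity m i j                         ∎
    ; intertwines = λ i j → begin
        sum (λ k → B i k * φ (e j) k)          ≈⟨ φA≈Bφ (e j) i ⟨
        φ (λ k → sum (λ l → A k l * e j l)) i  ≈⟨ IsLinearMap.φ-cong lin-φ (λ k → identityʳ A k j) i ⟩
        φ (λ k → A k j) i                      ≈⟨ apply lin-φ (λ k → A k j) i ⟨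
        sum (λ k → φ (e k) i * A k j)          ∎ })
    where
    e : ∀ {n} → Fin n → Vector Carrier n
    e {n} j k = identity n k j
    apply : ∀ {m n} {φ : Vector Carrier m → Vector Carrier n} → IsLinearMap φ →
            ∀ v i → sum (λ k → φ (e k) i * v k) ≈ φ v i
    apply {m} {φ = φ} lin v i = begin
      sum (λ k → φ (e k) i * v k)              ≈⟨ sum-cong-≋ (λ k → *-comm (φ (e k) i) (v k)) ⟩
      sum (λ k → v k * φ (e k) i)              ≈⟨ linear-sum lin v e i ⟨
      φ (λ l → sum (λ k → v k * e k l)) i      ≈⟨ IsLinearMap.φ-cong lin (λ l →
                                                    trans (sum-cong-≋ (λ k → *-comm (v k) (e k l)))
                                                      (identityˡ (λ k (_ : Fin 1) → v k) l zero)) i ⟩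
      φ v i                                    ∎
    P : Matrix n m
    P i j = φ (e j) i
    Q : Matrix m n
    Q i j = ψ (e j) i

-- Inverse square roots

module InverseRoot {c ℓ₁ ℓ₂} (ℝ : CompleteOrderedField c ℓ₁ ℓ₂) where
  open CompleteOrderedField ℝ hiding (zero)
  open SquareRoot ℝ
  open RealMatrices ℝ using (√; _†)
  open MatrixProperties commutativeRing using (sum)
  open SetoidReasoning setoid
  open SemiringSolver commutativeSemiring using (solve; _:=_; _:+_; _:*_)

  -- A description of the square root of x† that determines it, the sign being fixed by `nonNeg`.
  -- Weights can then be computed from these laws without unfolding the case distinctions in `√` and
  -- `†`.
  record IsInverseRoot (x s : Carrier) : Set (c ⊔ ℓ₁ ⊔ ℓ₂) where
    field
      nonNeg  : 0# ≤ s
      at-zero : x ≈ 0# → s ≈ 0#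
      at-unit : ¬ x ≈ 0# → s * s * x ≈ 1#

  *-cancelʳ : ∀ {x y z} → ¬ z ≈ 0# → x * z ≈ y * z → x ≈ y
  *-cancelʳ {x} {y} {z} z≉0 xz≈yz with inverse z z≉0
  ... | i , zi≈1 = begin
    x            ≈⟨ *-identityʳ x ⟨
    x * 1#       ≈⟨ *-congˡ zi≈1 ⟨
    x * (z * i)  ≈⟨ *-assoc x z i ⟨
    x * z * i    ≈⟨ *-congʳ xz≈yz ⟩
    y * z * i    ≈⟨ *-assoc y z i ⟩
    y * (z * i)  ≈⟨ *-congˡ zi≈1 ⟩
    y * 1#       ≈⟨ *-identityʳ y ⟩
    y            ∎

  square-zero : ∀ {x} → x * x ≈ 0# → x ≈ 0#
  square-zero {x} xx≈0 with x ≟ 0#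
  ... | yes x≈0 = x≈0
  ... | no  x≉0 = *-cancel-0 (proj₂ (inverse x x≉0)) xx≈0

  -- With y = x + d, equality of the squares says d² + 2xd = 0. Both terms are nonnegative, so d² =
  -- 0 and d = 0.
  square-injective-≤ : ∀ {x y} → 0# ≤ x → x ≤ y → x * x ≈ y * y → x ≈ y
  square-injective-≤ {x} {y} 0≤x x≤y xx≈yy with difference x≤y
  ... | d , 0≤d , x+d≈y = begin
    x       ≈⟨ +-identityʳ x ⟨
    x + 0#  ≈⟨ +-congˡ (square-zero (antisym dd≤0 (*-nonNeg 0≤d 0≤d))) ⟨
    x + d   ≈⟨ x+d≈y ⟩
    y       ∎
    where
    sum≈0 : d * d + (x + x) * d ≈ 0#
    sum≈0 = +-cancel (x * x) (begin
      x * x + (d * d + (x + x) * d)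
        ≈⟨ solve 2 (λ x d → x :* x :+ (d :* d :+ (x :+ x) :* d) := (x :+ d) :* (x :+ d)) refl x d ⟩
      (x + d) * (x + d)
        ≈⟨ *-cong x+d≈y x+d≈y ⟩
      y * y
        ≈⟨ xx≈yy ⟨
      x * x
        ≈⟨ +-identityʳ _ ⟨
      x * x + 0# ∎)
    dd≤0 : d * d ≤ 0#
    dd≤0 = ≤-respʳ-≈ sum≈0 (x≤x+y (d * d) (*-nonNeg (+-nonNeg 0≤x 0≤x) 0≤d))

  square-injective : ∀ {x y} → 0# ≤ x → 0# ≤ y → x * x ≈ y * y → x ≈ y
  square-injective {x} {y} 0≤x 0≤y xx≈yy with total x y
  ... | inj₁ x≤y = square-injective-≤ 0≤x x≤y xx≈yy
  ... | inj₂ y≤x = sym (square-injective-≤ 0≤y y≤x (sym xx≈yy))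

  √-nonNeg : ∀ x → 0# ≤ √ x
  √-nonNeg x with 0# ≤? x
  ... | yes 0≤x = proj₁ (proj₂ (squareRoot x 0≤x))
  ... | no  _   = ≤-refl

  √-square : ∀ {x} → 0# ≤ x → √ x * √ x ≈ x
  √-square {x} 0≤x with 0# ≤? x
  ... | yes 0≤x′ = proj₂ (proj₂ (squareRoot x 0≤x′))
  ... | no  0≰x  = contradiction 0≤x 0≰x

  †-zero : ∀ {x} → x ≈ 0# → x † ≈ 0#
  †-zero {x} x≈0 with x ≟ 0#
  ... | yes _   = refl
  ... | no  x≉0 = contradiction x≈0 x≉0

  †-inverse : ∀ {x} → ¬ x ≈ 0# → x * x † ≈ 1#
  †-inverse {x} x≉0 with x ≟ 0#
  ... | yes x≈0  = contradiction x≈0 x≉0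
  ... | no  x≉0′ = proj₂ (inverse x x≉0′)

  †-nonNeg : ∀ {x} → 0# ≤ x → 0# ≤ x †
  †-nonNeg {x} 0≤x with x ≟ 0#
  ... | yes _   = ≤-refl
  ... | no  x≉0 = inverse-nonNeg 0≤x (proj₂ (inverse x x≉0))

  √†-isInverseRoot : ∀ {x} → 0# ≤ x → IsInverseRoot x (√ (x †))
  √†-isInverseRoot {x} 0≤x = record
    { nonNeg  = √-nonNeg (x †)
    ; at-zero = λ x≈0 → square-zero (trans (√-square (†-nonNeg 0≤x)) (†-zero x≈0))
    ; at-unit = λ x≉0 → trans (*-congʳ (√-square (†-nonNeg 0≤x))) (trans (*-comm _ _) (†-inverse x≉0))
    }

  -- Allowing `x ≈ x′` includes the fact that equal row sums have equal weights, which is not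
  -- immediate from definitions by decision.
  inverseRoot-unique : ∀ {x x′ s s′} → x ≈ x′ → IsInverseRoot x s → IsInverseRoot x′ s′ → s ≈ s′
  inverseRoot-unique {x} {x′} x≈x′ S S′ with x ≟ 0#
  ... | yes x≈0 = trans (S.at-zero x≈0) (sym (S′.at-zero (trans (sym x≈x′) x≈0)))
    where module S = IsInverseRoot S
          module S′ = IsInverseRoot S′
  ... | no  x≉0 = square-injective S.nonNeg S′.nonNeg (*-cancelʳ x≉0
      (trans (S.at-unit x≉0) (sym (trans (*-congˡ x≈x′) (S′.at-unit λ x′≈0 → x≉0 (trans x≈x′ x′≈0))))))
    where module S = IsInverseRoot S
          module S′ = IsInverseRoot S′

  -- Splits the weight of a row sum n · r into a factor for n and a factor for r. The case r = 0 is
  -- covered, since a nonzero `a` can be cancelled.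
  inverseRoot-* : ∀ {a x s t} → ¬ a ≈ 0# → IsInverseRoot a s → IsInverseRoot x t → IsInverseRoot (a * x) (s * t)
  inverseRoot-* {a} {x} {s} {t} a≉0 S T = record
    { nonNeg  = *-nonNeg S.nonNeg T.nonNeg
    ; at-zero = λ ax≈0 → trans
        (*-congˡ (T.at-zero (*-cancel-0 (proj₂ (inverse a a≉0)) (trans (*-comm x a) ax≈0)))) (zeroʳ s)
    ; at-unit = λ ax≉0 → begin
        s * t * (s * t) * (a * x)
          ≈⟨ solve 4 (λ s t a x → s :* t :* (s :* t) :* (a :* x) := s :* s :* a :* (t :* t :* x)) refl s t a x ⟩
        s * s * a * (t * t * x)
          ≈⟨ *-cong (S.at-unit a≉0) (T.at-unit λ x≈0 → ax≉0 (trans (*-congˡ x≈0) (zeroʳ a))) ⟩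
        1# * 1#
          ≈⟨ *-identityʳ 1# ⟩
        1# ∎
    }
    where
    module S = IsInverseRoot S
    module T = IsInverseRoot T

  sum-nonNeg : ∀ {n} {f : Vector Carrier n} → (∀ i → 0# ≤ f i) → 0# ≤ sum f
  sum-nonNeg {zero}  0≤f = ≤-refl
  sum-nonNeg {suc n} 0≤f = +-nonNeg (0≤f zero) (sum-nonNeg (0≤f ∘ suc))

  sum-ones≉0 : ∀ n → ¬ sum {suc n} (λ _ → 1#) ≈ 0#
  sum-ones≉0 n 1+k≈0 = 1≰0 (≤-respʳ-≈ 1+k≈0 (x≤x+y 1# (sum-nonNeg {n} λ _ → 0≤1)))

-- The similarity of C(G) ⊕ 0 and D(G)

module Spread {c ℓ} (R : CommutativeRing c ℓ) (m : ℕ) (ι : CommutativeRing.Carrier R)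
              (ν*ι≈1 : SumProperties.IsReciprocal R (suc m) ι) where
  open CommutativeRing R hiding (zero)
  open MatrixProperties R
  open SumProperties R
  open Determinant R using (combination)
  open RingProperties ring using (-0#≈0#; -‿+-comm; -‿distribʳ-*; +-cancelʳ)
  open SetoidReasoning setoid
  open SemiringSolver commutativeSemiring using (solve; _:=_; _:+_; _:*_)

  -- The sequence with mean `a` whose later entries deviate from it by `v`. The first entry
  -- compensates for the others, so the total is (m + 1) · a whatever `v` is.
  spread : Carrier → Vector Carrier m → Vector Carrier (suc m)
  spread a v zero    = a + - sum v
  spread a v (suc k) = a + v k

  -- The deviation of the first entry is left out: it is minus the sum of the others.
  deviation : Vector Carrier (suc m) → Vector Carrier m
  deviation u k = u (suc k) + - (ι * sum u)

  +-minus : ∀ a b → a + (b + - a) ≈ b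
  +-minus a b = begin
    a + (b + - a)  ≈⟨ +-congˡ (+-comm b (- a)) ⟩
    a + (- a + b)  ≈⟨ +-assoc a (- a) b ⟨
    a + - a + b    ≈⟨ +-congʳ (-‿inverseʳ a) ⟩
    0# + b         ≈⟨ +-identityˡ b ⟩
    b              ∎

  ι-sum-const : ∀ a → ι * sum {suc m} (λ _ → a) ≈ a
  ι-sum-const a = begin
    ι * sum {suc m} (λ _ → a)         ≈⟨ *-congˡ (sum-const (suc m) a) ⟩
    ι * (sum {suc m} (λ _ → 1#) * a)  ≈⟨ *-assoc _ _ _ ⟨
    ι * sum {suc m} (λ _ → 1#) * a    ≈⟨ *-congʳ (trans (*-comm _ _) ν*ι≈1) ⟩
    1# * a                            ≈⟨ *-identityˡ a ⟩
    a                                 ∎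

  sum-const-ι : ∀ a → sum {suc m} (λ _ → ι * a) ≈ a
  sum-const-ι a = trans (sym (*-distribˡ-sum {suc m} ι (λ _ → a))) (ι-sum-const a)

  sum-spread : ∀ a v → sum (spread a v) ≈ sum {suc m} (λ _ → a)
  sum-spread a v = begin
    a + - sum v + sum (λ k → a + v k)              ≈⟨ +-congˡ (∑-distrib-+ {m} (λ _ → a) v) ⟩
    a + - sum v + (sum {m} (λ _ → a) + sum v)      ≈⟨ solve 4 (λ a n s b → a :+ n :+ (s :+ b) := a :+ s :+ (b :+ n)) refl a (- sum v) (sum {m} (λ _ → a)) (sum v) ⟩
    a + sum {m} (λ _ → a) + (sum v + - sum v)      ≈⟨ +-congˡ (-‿inverseʳ (sum v)) ⟩
    a + sum {m} (λ _ → a) + 0#                     ≈⟨ +-identityʳ _ ⟩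
    a + sum {m} (λ _ → a)                          ∎

  spread-cong : ∀ {a b u v} → a ≈ b → (∀ k → u k ≈ v k) → ∀ k → spread a u k ≈ spread b v k
  spread-cong a≈b u≈v zero    = +-cong a≈b (-‿cong (sum-cong-≋ u≈v))
  spread-cong a≈b u≈v (suc k) = +-cong a≈b (u≈v k)

  deviation-cong : ∀ {u v} → (∀ k → u k ≈ v k) → ∀ k → deviation u k ≈ deviation v k
  deviation-cong u≈v k = +-cong (u≈v (suc k)) (-‿cong (*-congˡ (sum-cong-≋ u≈v)))

  deviation-spread : ∀ a v k → deviation (spread a v) k ≈ v k
  deviation-spread a v k = begin
    a + v k + - (ι * sum (spread a v))         ≈⟨ +-congˡ (-‿cong (trans (*-congˡ (sum-spread a v)) (ι-sum-const a))) ⟩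
    a + v k + - a                              ≈⟨ +-assoc a (v k) (- a) ⟩
    a + (v k + - a)                            ≈⟨ +-minus a (v k) ⟩
    v k                                        ∎

  spread-deviation : ∀ u k → spread (ι * sum u) (deviation u) k ≈ u k
  spread-deviation u (suc k) = +-minus (ι * sum u) (u (suc k))
  -- The two sequences agree at the later entries and have the same total, so they agree at the
  -- first entry as well.
  spread-deviation u zero    = +-cancelʳ (sum (u ∘ suc)) _ _ (begin
    spread (ι * sum u) (deviation u) zero + sum (u ∘ suc)
      ≈⟨ +-congˡ (sum-cong-≋ (λ k → +-minus (ι * sum u) (u (suc k)))) ⟨
    sum (spread (ι * sum u) (deviation u))
      ≈⟨ sum-spread (ι * sum u) (deviation u) ⟩
    sum {suc m} (λ _ → ι * sum u)
      ≈⟨ sum-const-ι (sum u) ⟩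
    sum u ∎)

  deviation-const : ∀ a k → deviation (λ _ → a) k ≈ 0#
  deviation-const a k = trans (+-congˡ (-‿cong (ι-sum-const a))) (-‿inverseʳ a)

  spread-zero : ∀ a {v} → (∀ k → v k ≈ 0#) → ∀ k → spread a v k ≈ a
  spread-zero a v≈0 zero    = trans (+-congˡ (trans (-‿cong (sum-zero v≈0)) -0#≈0#)) (+-identityʳ a)
  spread-zero a v≈0 (suc k) = trans (+-congˡ (v≈0 k)) (+-identityʳ a)

  +-combination : ∀ x y a b a′ b′ → (x * a + y * b) + (x * a′ + y * b′) ≈ x * (a + a′) + y * (b + b′)
  +-combination = solve 6 (λ x y a b a′ b′ →
    (x :* a :+ y :* b) :+ (x :* a′ :+ y :* b′) := x :* (a :+ a′) :+ y :* (b :+ b′)) refl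

  neg-combination : ∀ x y a b → - (x * a + y * b) ≈ x * - a + y * - b
  neg-combination x y a b = trans (sym (-‿+-comm _ _)) (+-cong (-‿distribʳ-* x a) (-‿distribʳ-* y b))

  spread-linear : ∀ x y a b u v k →
    spread (x * a + y * b) (combination x y u v) k ≈ x * spread a u k + y * spread b v k
  spread-linear x y a b u v zero    = trans
    (+-congˡ (trans (-‿cong (sum-combination x y u v)) (neg-combination x y (sum u) (sum v))))
    (+-combination x y a b (- sum u) (- sum v))
  spread-linear x y a b u v (suc k) = +-combination x y a b (u k) (v k)

  deviation-linear : ∀ x y u v k →
    deviation (combination x y u v) k ≈ x * deviation u k + y * deviation v k
  deviation-linear x y u v k = begin
    x * u (suc k) + y * v (suc k) + - (ι * sum (combination x y u v))
      ≈⟨ +-congˡ (-‿cong (*-congˡ (sum-combination x y u v))) ⟩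
    x * u (suc k) + y * v (suc k) + - (ι * (x * sum u + y * sum v))
      ≈⟨ +-congˡ (-‿cong (solve 5 (λ i x y s t → i :* (x :* s :+ y :* t) := x :* (i :* s) :+ y :* (i :* t)) refl ι x y (sum u) (sum v))) ⟩
    x * u (suc k) + y * v (suc k) + - (x * (ι * sum u) + y * (ι * sum v))
      ≈⟨ +-congˡ (neg-combination x y (ι * sum u) (ι * sum v)) ⟩
    x * u (suc k) + y * v (suc k) + (x * - (ι * sum u) + y * - (ι * sum v))
      ≈⟨ +-combination x y (u (suc k)) (v (suc k)) (- (ι * sum u)) (- (ι * sum v)) ⟩
    x * deviation u k + y * deviation v k ∎

-- The change of coordinates between the spaces of C and D.

module BlockSimilarity {c ℓ} (R : CommutativeRing c ℓ) (m q d : ℕ) (ι : CommutativeRing.Carrier R)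
                       (ν*ι≈1 : SumProperties.IsReciprocal R (suc m) ι) where
  open CommutativeRing R hiding (zero)
  open MatrixProperties R
  open SumProperties R
  open Matrices rawRing
  open Determinant R using (combination; IsLinearMap)
  open Similarity R using (Similar)
  open LinearMaps R using (similar-linear)
  open Spread R m ι ν*ι≈1
  open SetoidReasoning setoid

  private
    p = q ℕ.+ d
    n = suc m

  -- The shape of `matrixC n`, over any commutative ring in which n has the inverse `ι`.
  bipartiteC : Matrix p q → Matrix (p ℕ.+ n ℕ.* q) (p ℕ.+ n ℕ.* q)
  bipartiteC G = block (zeros p p) (rowOfCopies n G) (columnOfCopies n (G ᵀ)) (zeros (n ℕ.* q) (n ℕ.* q))

  bipartiteD : Matrix p q → Matrix (q ℕ.+ n ℕ.* p) (q ℕ.+ n ℕ.* p)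
  bipartiteD G = block (zeros q q) (rowOfCopies n (G ᵀ)) (columnOfCopies n G) (zeros (n ℕ.* p) (n ℕ.* p))

  VectorC VectorD : Set c
  VectorC = Vector Carrier ((p ℕ.+ n ℕ.* q) ℕ.+ m ℕ.* d)
  VectorD = Vector Carrier (q ℕ.+ n ℕ.* p)

  -- Coordinates are named by block: x of length p, y of length q, z for the padding. C has one x
  -- and n copies of y, D has one y and n copies of x. Below, `κ` ranges over the n copies and `k`
  -- over the m deviations.
  xC : Fin p → Fin ((p ℕ.+ n ℕ.* q) ℕ.+ m ℕ.* d)
  xC i = (i ↑ˡ (n ℕ.* q)) ↑ˡ (m ℕ.* d)

  yC : Fin n → Fin q → Fin ((p ℕ.+ n ℕ.* q) ℕ.+ m ℕ.* d)
  yC k j = (p ↑ʳ combine {n} {q} k j) ↑ˡ (m ℕ.* d)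

  zC : Fin m → Fin d → Fin ((p ℕ.+ n ℕ.* q) ℕ.+ m ℕ.* d)
  zC k l = (p ℕ.+ n ℕ.* q) ↑ʳ combine {m} {d} k l

  yD : Fin q → Fin (q ℕ.+ n ℕ.* p)
  yD j = j ↑ˡ (n ℕ.* p)

  xD : Fin n → Fin p → Fin (q ℕ.+ n ℕ.* p)
  xD k i = q ↑ʳ combine {n} {p} k i

  elimC : ∀ {a} (P : Fin ((p ℕ.+ n ℕ.* q) ℕ.+ m ℕ.* d) → Set a) →
          (∀ i → P (xC i)) → (∀ k j → P (yC k j)) → (∀ k l → P (zC k l)) → ∀ e → P e
  elimC P x y z = ↑-elim P
    (↑-elim (λ e → P (e ↑ˡ (m ℕ.* d))) x (combine-elim {m = n} {q} (λ e → P ((p ↑ʳ e) ↑ˡ (m ℕ.* d))) y))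
    (combine-elim {m = m} {d} (λ e → P ((p ℕ.+ n ℕ.* q) ↑ʳ e)) z)

  elimD : ∀ {a} (P : Fin (q ℕ.+ n ℕ.* p) → Set a) →
          (∀ j → P (yD j)) → (∀ k i → P (xD k i)) → ∀ e → P e
  elimD P y x = ↑-elim P y (combine-elim {m = n} {p} (λ e → P (q ↑ʳ e)) x)

  vectorC : Vector Carrier p → (Fin n → Vector Carrier q) → (Fin m → Vector Carrier d) → VectorC
  vectorC x y z = (x ++ (λ e → uncurry y (remQuot {n} q e))) ++ (λ e → uncurry z (remQuot {m} d e))

  vectorD : Vector Carrier q → (Fin n → Vector Carrier p) → VectorD
  vectorD y x = y ++ (λ e → uncurry x (remQuot {n} p e))

  module _ (x : Vector Carrier p) (y : Fin n → Vector Carrier q) (z : Fin m → Vector Carrier d) where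
    private
      y′ : Vector Carrier (n ℕ.* q)
      y′ e = uncurry y (remQuot {n} q e)
      z′ : Vector Carrier (m ℕ.* d)
      z′ e = uncurry z (remQuot {m} d e)

    vectorC-x : ∀ i → vectorC x y z (xC i) ≈ x i
    vectorC-x i = reflexive (≡.trans (lookup-++ˡ (x ++ y′) z′ (i ↑ˡ (n ℕ.* q))) (lookup-++ˡ x y′ i))

    vectorC-y : ∀ k j → vectorC x y z (yC k j) ≈ y k j
    vectorC-y k j = reflexive (≡.trans (lookup-++ˡ (x ++ y′) z′ (p ↑ʳ combine {n} {q} k j))
      (≡.trans (lookup-++ʳ x y′ (combine {n} {q} k j)) (≡.cong (uncurry y) (Fin.remQuot-combine {n} {q} k j))))

    vectorC-z : ∀ k l → vectorC x y z (zC k l) ≈ z k l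
    vectorC-z k l = reflexive (≡.trans (lookup-++ʳ (x ++ y′) z′ (combine {m} {d} k l))
      (≡.cong (uncurry z) (Fin.remQuot-combine {m} {d} k l)))

  module _ (y : Vector Carrier q) (x : Fin n → Vector Carrier p) where
    private
      x′ : Vector Carrier (n ℕ.* p)
      x′ e = uncurry x (remQuot {n} p e)

    vectorD-y : ∀ j → vectorD y x (yD j) ≈ y j
    vectorD-y j = reflexive (lookup-++ˡ y x′ j)

    vectorD-x : ∀ k i → vectorD y x (xD k i) ≈ x k i
    vectorD-x k i = reflexive (≡.trans (lookup-++ʳ y x′ (combine {n} {p} k i))
      (≡.cong (uncurry x) (Fin.remQuot-combine {n} {p} k i)))

  -- The role of the padding: its `k`-th piece of length d extends the `k`-th deviation of the
  -- y-blocks, of length q, to a vector of length q + d = p, which can serve as a deviation of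
  -- x-blocks.
  excess : VectorC → Fin m → Vector Carrier p
  excess v k = (λ j → deviation (λ κ → v (yC κ j)) k) ++ (λ l → v (zC k l))

  excess-y : ∀ v k j → excess v k (j ↑ˡ d) ≈ deviation (λ κ → v (yC κ j)) k
  excess-y v k j = reflexive (lookup-++ˡ (λ j → deviation (λ κ → v (yC κ j)) k) (λ l → v (zC k l)) j)

  excess-z : ∀ v k l → excess v k (q ↑ʳ l) ≈ v (zC k l)
  excess-z v k l = reflexive (lookup-++ʳ (λ j → deviation (λ κ → v (yC κ j)) k) (λ l → v (zC k l)) l)

  φ-y : VectorC → Vector Carrier q
  φ-y v j = sum (λ κ → v (yC κ j))

  φ-x : VectorC → Fin n → Vector Carrier p
  φ-x v κ i = spread (v (xC i)) (λ k → excess v k i) κ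

  -- The x-block becomes the mean of the new x-blocks, while the y-blocks are replaced by their sum
  -- Y. In the coordinates (x, Y) both block matrices act by the same formula, (x, Y) ↦ (G Y, n Gᵀ
  -- x), and both are zero on the deviations.
  φ : VectorC → VectorD
  φ v = vectorD (φ-y v) (φ-x v)

  ψ-x : VectorD → Vector Carrier p
  ψ-x u i = ι * sum (λ κ → u (xD κ i))

  ψ-y : VectorD → Fin n → Vector Carrier q
  ψ-y u κ j = spread (ι * u (yD j)) (deviation (λ κ → u (xD κ (j ↑ˡ d)))) κ

  ψ-z : VectorD → Fin m → Vector Carrier d
  ψ-z u k l = deviation (λ κ → u (xD κ (q ↑ʳ l))) k

  ψ : VectorD → VectorC
  ψ u = vectorC (ψ-x u) (ψ-y u) (ψ-z u)

  excess-cong : ∀ {u v} → (∀ e → u e ≈ v e) → ∀ k i → excess u k i ≈ excess v k i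
  excess-cong {u} {v} u≈v k = ↑-elim (λ i → excess u k i ≈ excess v k i)
    (λ j → trans (excess-y u k j) (trans (deviation-cong (λ κ → u≈v (yC κ j)) k) (sym (excess-y v k j))))
    (λ l → trans (excess-z u k l) (trans (u≈v (zC k l)) (sym (excess-z v k l))))

  excess-linear : ∀ x y u v k i → excess (combination x y u v) k i ≈ x * excess u k i + y * excess v k i
  excess-linear x y u v k = ↑-elim (λ i → excess (combination x y u v) k i ≈ x * excess u k i + y * excess v k i)
    (λ j → trans (excess-y (combination x y u v) k j)
      (trans (deviation-linear x y (λ κ → u (yC κ j)) (λ κ → v (yC κ j)) k)
        (sym (+-cong (*-congˡ (excess-y u k j)) (*-congˡ (excess-y v k j))))))
    (λ l → trans (excess-z (combination x y u v) k l)
      (sym (+-cong (*-congˡ (excess-z u k l)) (*-congˡ (excess-z v k l)))))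

  φ-isLinearMap : IsLinearMap φ
  φ-isLinearMap = record
    { φ-cong = λ {u} {v} u≈v → elimD (λ e → φ u e ≈ φ v e)
        (λ j → trans (vectorD-y (φ-y u) (φ-x u) j)
          (trans (sum-cong-≋ {n} λ κ → u≈v (yC κ j)) (sym (vectorD-y (φ-y v) (φ-x v) j))))
        (λ κ i → trans (vectorD-x (φ-y u) (φ-x u) κ i)
          (trans (spread-cong (u≈v (xC i)) (λ k → excess-cong u≈v k i) κ) (sym (vectorD-x (φ-y v) (φ-x v) κ i))))
    ; φ-linear = λ x y u v → elimD (λ e → φ (combination x y u v) e ≈ combination x y (φ u) (φ v) e)
        (λ j → trans (vectorD-y (φ-y (combination x y u v)) (φ-x (combination x y u v)) j)
          (trans (sum-combination x y (λ κ → u (yC κ j)) (λ κ → v (yC κ j)))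
            (sym (+-cong (*-congˡ (vectorD-y (φ-y u) (φ-x u) j)) (*-congˡ (vectorD-y (φ-y v) (φ-x v) j))))))
        (λ κ i → trans (vectorD-x (φ-y (combination x y u v)) (φ-x (combination x y u v)) κ i)
          (trans (spread-cong refl (λ k → excess-linear x y u v k i) κ)
            (trans (spread-linear x y (u (xC i)) (v (xC i)) (λ k → excess u k i) (λ k → excess v k i) κ)
              (sym (+-cong (*-congˡ (vectorD-x (φ-y u) (φ-x u) κ i)) (*-congˡ (vectorD-x (φ-y v) (φ-x v) κ i)))))))
    }

  ψ-isLinearMap : IsLinearMap ψ
  ψ-isLinearMap = record
    { φ-cong = λ {u} {v} u≈v → elimC (λ e → ψ u e ≈ ψ v e)
        (λ i → trans (vectorC-x (ψ-x u) (ψ-y u) (ψ-z u) i)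
          (trans (*-congˡ (sum-cong-≋ {n} λ κ → u≈v (xD κ i))) (sym (vectorC-x (ψ-x v) (ψ-y v) (ψ-z v) i))))
        (λ κ j → trans (vectorC-y (ψ-x u) (ψ-y u) (ψ-z u) κ j)
          (trans (spread-cong (*-congˡ (u≈v (yD j))) (deviation-cong λ κ → u≈v (xD κ (j ↑ˡ d))) κ)
            (sym (vectorC-y (ψ-x v) (ψ-y v) (ψ-z v) κ j))))
        (λ k l → trans (vectorC-z (ψ-x u) (ψ-y u) (ψ-z u) k l)
          (trans (deviation-cong (λ κ → u≈v (xD κ (q ↑ʳ l))) k) (sym (vectorC-z (ψ-x v) (ψ-y v) (ψ-z v) k l))))
    ; φ-linear = λ x y u v → let w = combination x y u v in
      elimC (λ e → ψ w e ≈ combination x y (ψ u) (ψ v) e)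
        (λ i → trans (vectorC-x (ψ-x w) (ψ-y w) (ψ-z w) i)
          (trans (trans (*-congˡ (sum-combination x y (λ κ → u (xD κ i)) (λ κ → v (xD κ i))))
                   (ι-combination x y (sum (λ κ → u (xD κ i))) (sum (λ κ → v (xD κ i)))))
            (sym (+-cong (*-congˡ (vectorC-x (ψ-x u) (ψ-y u) (ψ-z u) i))
                         (*-congˡ (vectorC-x (ψ-x v) (ψ-y v) (ψ-z v) i))))))
        (λ κ j → trans (vectorC-y (ψ-x w) (ψ-y w) (ψ-z w) κ j)
          (trans (trans (spread-cong (ι-combination x y (u (yD j)) (v (yD j)))
                     (deviation-linear x y (λ κ → u (xD κ (j ↑ˡ d))) (λ κ → v (xD κ (j ↑ˡ d)))) κ)
                   (spread-linear x y _ _ _ _ κ))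
            (sym (+-cong (*-congˡ (vectorC-y (ψ-x u) (ψ-y u) (ψ-z u) κ j))
                         (*-congˡ (vectorC-y (ψ-x v) (ψ-y v) (ψ-z v) κ j))))))
        (λ k l → trans (vectorC-z (ψ-x w) (ψ-y w) (ψ-z w) k l)
          (trans (deviation-linear x y (λ κ → u (xD κ (q ↑ʳ l))) (λ κ → v (xD κ (q ↑ʳ l))) k)
            (sym (+-cong (*-congˡ (vectorC-z (ψ-x u) (ψ-y u) (ψ-z u) k l))
                         (*-congˡ (vectorC-z (ψ-x v) (ψ-y v) (ψ-z v) k l))))))
    }
    where
    open CommutativeSemigroupProperties *-commutativeSemigroup using (x∙yz≈y∙xz)
    ι-combination : ∀ x y a b → ι * (x * a + y * b) ≈ x * (ι * a) + y * (ι * b)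
    ι-combination x y a b = trans (distribˡ _ _ _) (+-cong (x∙yz≈y∙xz _ _ _) (x∙yz≈y∙xz _ _ _))

  φ-at-xD : ∀ v κ i → φ v (xD κ i) ≈ spread (v (xC i)) (λ k → excess v k i) κ
  φ-at-xD v = vectorD-x (φ-y v) (φ-x v)

  φ-at-yD : ∀ v j → φ v (yD j) ≈ sum (λ κ → v (yC κ j))
  φ-at-yD v = vectorD-y (φ-y v) (φ-x v)

  sum-φ-x : ∀ v i → sum (λ κ → φ v (xD κ i)) ≈ sum {n} (λ _ → v (xC i))
  sum-φ-x v i = trans (sum-cong-≋ {n} λ κ → φ-at-xD v κ i) (sum-spread (v (xC i)) (λ k → excess v k i))

  deviation-φ-x : ∀ v i k → deviation (λ κ → φ v (xD κ i)) k ≈ excess v k i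
  deviation-φ-x v i k = trans (deviation-cong (λ κ → φ-at-xD v κ i) k)
                              (deviation-spread (v (xC i)) (λ k → excess v k i) k)

  ψ-φ : ∀ v e → ψ (φ v) e ≈ v e
  ψ-φ v = elimC (λ e → ψ (φ v) e ≈ v e)
    (λ i → begin
      ψ u (xC i)                                  ≈⟨ vectorC-x (ψ-x u) (ψ-y u) (ψ-z u) i ⟩
      ι * sum (λ κ → u (xD κ i))                  ≈⟨ *-congˡ (sum-φ-x v i) ⟩
      ι * sum {n} (λ _ → v (xC i))                ≈⟨ ι-sum-const (v (xC i)) ⟩
      v (xC i)                                    ∎)
    (λ κ j → begin
      ψ u (yC κ j)
        ≈⟨ vectorC-y (ψ-x u) (ψ-y u) (ψ-z u) κ j ⟩
      spread (ι * u (yD j)) (deviation (λ κ → u (xD κ (j ↑ˡ d)))) κ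
        ≈⟨ spread-cong (*-congˡ (φ-at-yD v j)) (λ k → trans (deviation-φ-x v (j ↑ˡ d) k) (excess-y v k j)) κ ⟩
      spread (ι * sum (λ κ → v (yC κ j))) (deviation (λ κ → v (yC κ j))) κ
        ≈⟨ spread-deviation (λ κ → v (yC κ j)) κ ⟩
      v (yC κ j) ∎)
    (λ k l → begin
      ψ u (zC k l)                                ≈⟨ vectorC-z (ψ-x u) (ψ-y u) (ψ-z u) k l ⟩
      deviation (λ κ → u (xD κ (q ↑ʳ l))) k       ≈⟨ deviation-φ-x v (q ↑ʳ l) k ⟩
      excess v k (q ↑ʳ l)                         ≈⟨ excess-z v k l ⟩
      v (zC k l)                                  ∎)
    where
    u = φ v

  φ-ψ : ∀ u e → φ (ψ u) e ≈ u e
  φ-ψ u = elimD (λ e → φ (ψ u) e ≈ u e)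
    (λ j → begin
      φ v (yD j)                                  ≈⟨ φ-at-yD v j ⟩
      sum (λ κ → v (yC κ j))                      ≈⟨ sum-cong-≋ {n} (λ κ → vectorC-y (ψ-x u) (ψ-y u) (ψ-z u) κ j) ⟩
      sum (λ κ → ψ-y u κ j)                       ≈⟨ sum-spread (ι * u (yD j)) (deviation (λ κ → u (xD κ (j ↑ˡ d)))) ⟩
      sum {n} (λ _ → ι * u (yD j))                ≈⟨ sum-const-ι (u (yD j)) ⟩
      u (yD j)                                    ∎)
    (λ κ i → begin
      φ v (xD κ i)
        ≈⟨ φ-at-xD v κ i ⟩
      spread (v (xC i)) (λ k → excess v k i) κ
        ≈⟨ spread-cong (vectorC-x (ψ-x u) (ψ-y u) (ψ-z u) i) (λ k → excess-ψ k i) κ ⟩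
      spread (ι * sum (λ κ → u (xD κ i))) (deviation (λ κ → u (xD κ i))) κ
        ≈⟨ spread-deviation (λ κ → u (xD κ i)) κ ⟩
      u (xD κ i) ∎)
    where
    v = ψ u
    excess-ψ : ∀ k i → excess v k i ≈ deviation (λ κ → u (xD κ i)) k
    excess-ψ k = ↑-elim (λ i → excess v k i ≈ deviation (λ κ → u (xD κ i)) k)
      (λ j → trans (excess-y v k j) (trans
        (deviation-cong (λ κ → vectorC-y (ψ-x u) (ψ-y u) (ψ-z u) κ j) k)
        (deviation-spread (ι * u (yD j)) (deviation (λ κ → u (xD κ (j ↑ˡ d)))) k)))
      (λ l → trans (excess-z v k l) (vectorC-z (ψ-x u) (ψ-y u) (ψ-z u) k l))

  module _ (G : Matrix p q) where
    C⊕0 = bipartiteC G ⊕ zeros (m ℕ.* d) (m ℕ.* d)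
    D = bipartiteD G

    -- This and its companions have two uses: in `intertwines`, and for `B` with the all-ones
    -- vector, where they give the row sums.
    C-at-x : ∀ v i → sum (λ e → C⊕0 (xC i) e * v e) ≈ sum {n} (λ κ → sum (λ j → G i j * v (yC κ j)))
    C-at-x v i = begin
      sum (λ e → C⊕0 (xC i) e * v e)
        ≈⟨ ⊕-zeros-*-ˡ (bipartiteC G) v (i ↑ˡ (n ℕ.* q)) ⟩
      sum (λ e → bipartiteC G (i ↑ˡ (n ℕ.* q)) e * w e)
        ≈⟨ block-*-ˡ (zeros p p) (rowOfCopies n G) (columnOfCopies n (G ᵀ)) (zeros _ _) w i ⟩
      sum {p} (λ i′ → 0# * w (i′ ↑ˡ (n ℕ.* q))) + sum (λ e → rowOfCopies n G i e * w (p ↑ʳ e))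
        ≈⟨ trans (+-congʳ (zeros-* {p} (λ i′ → w (i′ ↑ˡ (n ℕ.* q))))) (+-identityˡ _) ⟩
      sum (λ e → rowOfCopies n G i e * w (p ↑ʳ e))
        ≈⟨ rowOfCopies-* n G (λ e → w (p ↑ʳ e)) i ⟩
      sum (λ κ → sum (λ j → G i j * v (yC κ j))) ∎
      where
      w : Vector Carrier (p ℕ.+ n ℕ.* q)
      w e = v (e ↑ˡ (m ℕ.* d))

    C-at-y : ∀ v κ j → sum (λ e → C⊕0 (yC κ j) e * v e) ≈ sum (λ i → G i j * v (xC i))
    C-at-y v κ j = begin
      sum (λ e → C⊕0 (yC κ j) e * v e)
        ≈⟨ ⊕-zeros-*-ˡ (bipartiteC G) v (p ↑ʳ f) ⟩
      sum (λ e → bipartiteC G (p ↑ʳ f) e * w e)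
        ≈⟨ block-*-ʳ (zeros p p) (rowOfCopies n G) (columnOfCopies n (G ᵀ)) (zeros _ _) w f ⟩
      sum (λ i → columnOfCopies n (G ᵀ) f i * w (i ↑ˡ (n ℕ.* q))) + sum (λ e → 0# * w (p ↑ʳ e))
        ≈⟨ trans (+-congˡ (zeros-* (λ e → w (p ↑ʳ e)))) (+-identityʳ _) ⟩
      sum (λ i → columnOfCopies n (G ᵀ) f i * w (i ↑ˡ (n ℕ.* q)))
        ≈⟨ columnOfCopies-* n (G ᵀ) (λ i → w (i ↑ˡ (n ℕ.* q))) κ j ⟩
      sum (λ i → G i j * v (xC i)) ∎
      where
      w : Vector Carrier (p ℕ.+ n ℕ.* q)
      w e = v (e ↑ˡ (m ℕ.* d))
      f = combine {n} {q} κ j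

    C-at-z : ∀ v k l → sum (λ e → C⊕0 (zC k l) e * v e) ≈ 0#
    C-at-z v k l = ⊕-zeros-*-ʳ (bipartiteC G) v (combine {m} {d} k l)

    D-at-y : ∀ v j → sum (λ e → D (yD j) e * v e) ≈ sum {n} (λ κ → sum (λ i → G i j * v (xD κ i)))
    D-at-y v j = begin
      sum (λ e → D (yD j) e * v e)
        ≈⟨ block-*-ˡ (zeros q q) (rowOfCopies n (G ᵀ)) (columnOfCopies n G) (zeros _ _) v j ⟩
      sum (λ j′ → 0# * v (yD j′)) + sum (λ e → rowOfCopies n (G ᵀ) j e * v (q ↑ʳ e))
        ≈⟨ trans (+-congʳ (zeros-* (λ j′ → v (yD j′)))) (+-identityˡ _) ⟩
      sum (λ e → rowOfCopies n (G ᵀ) j e * v (q ↑ʳ e))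
        ≈⟨ rowOfCopies-* n (G ᵀ) (λ e → v (q ↑ʳ e)) j ⟩
      sum (λ κ → sum (λ i → G i j * v (xD κ i))) ∎

    D-at-x : ∀ v κ i → sum (λ e → D (xD κ i) e * v e) ≈ sum (λ j → G i j * v (yD j))
    D-at-x v κ i = begin
      sum (λ e → D (xD κ i) e * v e)
        ≈⟨ block-*-ʳ (zeros q q) (rowOfCopies n (G ᵀ)) (columnOfCopies n G) (zeros _ _) v (combine {n} {p} κ i) ⟩
      sum (λ j → columnOfCopies n G (combine {n} {p} κ i) j * v (yD j)) + sum (λ e → 0# * v (q ↑ʳ e))
        ≈⟨ trans (+-congˡ (zeros-* (λ e → v (q ↑ʳ e)))) (+-identityʳ _) ⟩
      sum (λ j → columnOfCopies n G (combine {n} {p} κ i) j * v (yD j))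
        ≈⟨ columnOfCopies-* n G (λ j → v (yD j)) κ i ⟩
      sum (λ j → G i j * v (yD j)) ∎

    sum-sum-* : ∀ {a} (g : Vector Carrier a) (v : Fin n → Vector Carrier a) →
                sum (λ κ → sum (λ i → g i * v κ i)) ≈ sum (λ i → g i * sum (λ κ → v κ i))
    sum-sum-* g v = trans (∑-comm (λ κ i → g i * v κ i))
                          (sum-cong-≋ λ i → sym (*-distribˡ-sum (g i) (λ κ → v κ i)))

    intertwines : ∀ v e → φ (λ f → sum (λ g → C⊕0 f g * v g)) e ≈ sum (λ g → D e g * φ v g)
    intertwines v = elimD (λ e → φ Cv e ≈ sum (λ g → D e g * φ v g))
      (λ j → begin
        φ Cv (yD j)
          ≈⟨ φ-at-yD Cv j ⟩
        sum (λ κ → Cv (yC κ j))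
          ≈⟨ sum-cong-≋ {n} (λ κ → C-at-y v κ j) ⟩
        sum {n} (λ κ → sum (λ i → G i j * v (xC i)))
          ≈⟨ sum-sum-* (λ i → G i j) (λ κ i → v (xC i)) ⟩
        sum (λ i → G i j * sum {n} (λ κ → v (xC i)))
          ≈⟨ sum-cong-≋ {p} (λ i → *-congˡ (sum-φ-x v i)) ⟨
        sum (λ i → G i j * sum (λ κ → φ v (xD κ i)))
          ≈⟨ sum-sum-* (λ i → G i j) (λ κ i → φ v (xD κ i)) ⟨
        sum {n} (λ κ → sum (λ i → G i j * φ v (xD κ i)))
          ≈⟨ D-at-y (φ v) j ⟨
        sum (λ g → D (yD j) g * φ v g) ∎)
      (λ κ i → begin
        φ Cv (xD κ i)
          ≈⟨ φ-at-xD Cv κ i ⟩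
        spread (Cv (xC i)) (λ k → excess Cv k i) κ
          -- The y-blocks of `Cv` are all equal and its padding is zero, so it has no deviations.
          ≈⟨ spread-zero (Cv (xC i)) (λ k → excess-Cv k i) κ ⟩
        Cv (xC i)
          ≈⟨ C-at-x v i ⟩
        sum {n} (λ κ → sum (λ j → G i j * v (yC κ j)))
          ≈⟨ sum-sum-* (λ j → G i j) (λ κ j → v (yC κ j)) ⟩
        sum (λ j → G i j * sum (λ κ → v (yC κ j)))
          ≈⟨ sum-cong-≋ {q} (λ j → *-congˡ (φ-at-yD v j)) ⟨
        sum (λ j → G i j * φ v (yD j))
          ≈⟨ D-at-x (φ v) κ i ⟨
        sum (λ g → D (xD κ i) g * φ v g) ∎)
      where
      Cv : VectorC
      Cv f = sum (λ g → C⊕0 f g * v g)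
      excess-Cv : ∀ k i → excess Cv k i ≈ 0#
      excess-Cv k = ↑-elim (λ i → excess Cv k i ≈ 0#)
        (λ j → trans (excess-y Cv k j)
          (trans (deviation-cong (λ κ → C-at-y v κ j) k) (deviation-const _ k)))
        (λ l → trans (excess-z Cv k l) (C-at-z v k l))

    similarity : Similar C⊕0 D
    similarity = similar-linear φ-isLinearMap ψ-isLinearMap ψ-φ φ-ψ intertwines

-- Normalized Laplacians

module Scaling {c ℓ} (R : CommutativeRing c ℓ) where
  open CommutativeRing R hiding (zero)
  open Matrices rawRing
  open SumProperties R

  -- The product diag(s) A diag(t), entry by entry. The two weight vectors are separate because
  -- restricting a symmetric weighting to an off-diagonal block gives different weights on its rows
  -- and columns.
  Scales : ∀ {m n} → Vector Carrier m → Vector Carrier n → Matrix m n → Matrix m n → Set ℓ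
  Scales s t A A′ = ∀ i j → s i * A i j * t j ≈ A′ i j

  scales-zeros : ∀ {m n} (s : Vector Carrier m) (t : Vector Carrier n) → Scales s t (zeros m n) (zeros m n)
  scales-zeros s t i j = trans (*-congʳ (zeroʳ (s i))) (zeroˡ (t j))

  scales-block : ∀ {m m′ n n′} (s : Vector Carrier (m ℕ.+ m′)) (t : Vector Carrier (n ℕ.+ n′))
    {A A′ : Matrix m n} {B B′ : Matrix m n′} {C C′ : Matrix m′ n} {D D′ : Matrix m′ n′} →
    Scales (s ∘ (_↑ˡ m′)) (t ∘ (_↑ˡ n′)) A A′ → Scales (s ∘ (_↑ˡ m′)) (t ∘ (n ↑ʳ_)) B B′ →
    Scales (s ∘ (m ↑ʳ_)) (t ∘ (_↑ˡ n′)) C C′ → Scales (s ∘ (m ↑ʳ_)) (t ∘ (n ↑ʳ_)) D D′ →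
    Scales s t (block A B C D) (block A′ B′ C′ D′)
  scales-block {m} {m′} {n} {n′} s t {A} {A′} {B} {B′} {C} {C′} {D} {D′} a b c d = ↑-elim _
    (λ i → ↑-elim (λ e → Scaled (i ↑ˡ m′) e)
      (λ j → transport (block-ˡˡ A B C D i j) (block-ˡˡ A′ B′ C′ D′ i j) (a i j))
      (λ j → transport (block-ˡʳ A B C D i j) (block-ˡʳ A′ B′ C′ D′ i j) (b i j)))
    (λ i → ↑-elim (λ e → Scaled (m ↑ʳ i) e)
      (λ j → transport (block-ʳˡ A B C D i j) (block-ʳˡ A′ B′ C′ D′ i j) (c i j))
      (λ j → transport (block-ʳʳ A B C D i j) (block-ʳʳ A′ B′ C′ D′ i j) (d i j)))
    where
    Scaled : Fin (m ℕ.+ m′) → Fin (n ℕ.+ n′) → Set ℓ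
    Scaled e f = s e * block A B C D e f * t f ≈ block A′ B′ C′ D′ e f
    transport : ∀ {x y a a′ b b′} → a ≡ b → a′ ≡ b′ → x * b * y ≈ b′ → x * a * y ≈ a′
    transport ≡.refl ≡.refl eq = eq

  scales-rowOfCopies : ∀ k {m n} {s : Vector Carrier m} {t : Vector Carrier (k ℕ.* n)} {A A′ : Matrix m n} →
    (∀ l → Scales s (λ j → t (combine {k} l j)) A A′) → Scales s t (rowOfCopies k A) (rowOfCopies k A′)
  scales-rowOfCopies k {n = n} {s} {t} {A} {A′} scales i =
    combine-elim {m = k} {n} (λ e → s i * rowOfCopies k A i e * t e ≈ rowOfCopies k A′ i e) λ l j →
      trans (*-congʳ (*-congˡ (reflexive (rowOfCopies-combine k A i l j))))
            (trans (scales l i j) (reflexive (≡.sym (rowOfCopies-combine k A′ i l j))))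

  scales-columnOfCopies : ∀ k {m n} {s : Vector Carrier (k ℕ.* m)} {t : Vector Carrier n} {A A′ : Matrix m n} →
    (∀ l → Scales (λ i → s (combine {k} l i)) t A A′) → Scales s t (columnOfCopies k A) (columnOfCopies k A′)
  scales-columnOfCopies k {m = m} {s = s} {t} {A} {A′} scales e j =
    combine-elim {m = k} {m} (λ e → s e * columnOfCopies k A e j * t j ≈ columnOfCopies k A′ e j) (λ l i →
      trans (*-congʳ (*-congˡ (reflexive (columnOfCopies-combine k A l i j))))
            (trans (scales l i j) (reflexive (≡.sym (columnOfCopies-combine k A′ l i j))))) e

-- Weights and Laplacians of the two block matrices.

module Laplacian {c ℓ₁ ℓ₂} (ℝ : CompleteOrderedField c ℓ₁ ℓ₂) where
  open CompleteOrderedField ℝ hiding (zero)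
  open RealMatrices ℝ
  open MatrixProperties commutativeRing
  open SumProperties commutativeRing
  open Scaling commutativeRing
  open Similarity commutativeRing
  open InverseRoot ℝ
  open SquareRoot ℝ using (0≤1)
  open SetoidReasoning setoid
  open SemiringSolver commutativeSemiring using (solve; _:=_; _:*_)

  weight : ∀ {n} → Matrix n n → Vector Carrier n
  weight M i = √ (rowSum M i †)

  normalizedLaplacian-entry : ∀ {n} (M M′ : Matrix n n) → Scales (weight M) (weight M) M M′ →
    ∀ i j → (identity n ⊖ M′) i j ≈ normalizedLaplacian M i j
  normalizedLaplacian-entry M M′ scales i j = +-congˡ (-‿cong (sym (trans
    (diagonalʳ (λ k → sum (λ l → diagonal (weight M) i l * M l k)) (weight M) j)
    (trans (*-congʳ (diagonalˡ (weight M) (λ l → M l j) i)) (scales i j)))))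

  -- Row sums are the action on the all-ones vector, so the formulas for the block matrices apply to
  -- them.
  rowSum-* : ∀ {m n} (A : Matrix m n) i → rowSum A i ≈ sum (λ j → A i j * 1#)
  rowSum-* A i = sum-cong-≋ λ j → sym (*-identityʳ (A i j))

  module _ (m q d : ℕ) (B : Matrix (q ℕ.+ d) q) (0≤B : NonNegative B) where
    private
      p = q ℕ.+ d
      n = suc m

    ν : Carrier
    ν = sum {n} (λ _ → 1#)

    open BlockSimilarity commutativeRing m q d (proj₁ (inverse ν (sum-ones≉0 m))) (proj₂ (inverse ν (sum-ones≉0 m)))
      using (xC; yC; xD; yD; C-at-x; C-at-y; D-at-x; D-at-y; similarity)

    C⊕0 : Matrix ((p ℕ.+ n ℕ.* q) ℕ.+ m ℕ.* d) ((p ℕ.+ n ℕ.* q) ℕ.+ m ℕ.* d)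
    C⊕0 = matrixC n B ⊕ zeros (m ℕ.* d) (m ℕ.* d)

    D : Matrix (q ℕ.+ n ℕ.* p) (q ℕ.+ n ℕ.* p)
    D = matrixD n B

    √† : Carrier → Carrier
    √† x = √ (x †)

    r : Vector Carrier p
    r i = rowSum B i

    s : Vector Carrier q
    s j = rowSum (B ᵀ) j

    ν-inverseRoot : IsInverseRoot ν (√† ν)
    ν-inverseRoot = √†-isInverseRoot (sum-nonNeg {n} λ _ → 0≤1)

    weight-≈ : ∀ {N} (M : Matrix N N) i {x t} → 0# ≤ x → rowSum M i ≈ x → IsInverseRoot x t → weight M i ≈ t
    weight-≈ M i 0≤x eq T = inverseRoot-unique eq (√†-isInverseRoot (≤-respʳ-≈ (sym eq) 0≤x)) T

    0≤r : ∀ i → 0# ≤ r i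
    0≤r i = sum-nonNeg (0≤B i)

    0≤s : ∀ j → 0# ≤ s j
    0≤s j = sum-nonNeg λ i → 0≤B i j

    0≤ν* : ∀ {x} → 0# ≤ x → 0# ≤ ν * x
    0≤ν* = *-nonNeg (sum-nonNeg {n} λ _ → 0≤1)

    weightC-x : ∀ i → weight C⊕0 (xC i) ≈ √† ν * √† (r i)
    weightC-x i = weight-≈ C⊕0 (xC i) (0≤ν* (0≤r i))
      (begin
        rowSum C⊕0 (xC i)                             ≈⟨ rowSum-* C⊕0 (xC i) ⟩
        sum (λ e → C⊕0 (xC i) e * 1#)                 ≈⟨ C-at-x B (λ _ → 1#) i ⟩
        sum {n} (λ _ → sum (λ j → B i j * 1#))        ≈⟨ sum-const n _ ⟩
        ν * sum (λ j → B i j * 1#)                    ≈⟨ *-congˡ (rowSum-* B i) ⟨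
        ν * r i                                       ∎)
      (inverseRoot-* (sum-ones≉0 m) ν-inverseRoot (√†-isInverseRoot (0≤r i)))

    weightC-y : ∀ κ j → weight C⊕0 (yC κ j) ≈ √† (s j)
    weightC-y κ j = weight-≈ C⊕0 (yC κ j) (0≤s j)
      (trans (rowSum-* C⊕0 (yC κ j)) (trans (C-at-y B (λ _ → 1#) κ j) (sym (rowSum-* (B ᵀ) j))))
      (√†-isInverseRoot (0≤s j))

    weightD-y : ∀ j → weight D (yD j) ≈ √† ν * √† (s j)
    weightD-y j = weight-≈ D (yD j) (0≤ν* (0≤s j))
      (begin
        rowSum D (yD j)                               ≈⟨ rowSum-* D (yD j) ⟩
        sum (λ e → D (yD j) e * 1#)                   ≈⟨ D-at-y B (λ _ → 1#) j ⟩
        sum {n} (λ _ → sum (λ i → B i j * 1#))        ≈⟨ sum-const n _ ⟩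
        ν * sum (λ i → B i j * 1#)                    ≈⟨ *-congˡ (rowSum-* (B ᵀ) j) ⟨
        ν * s j                                       ∎)
      (inverseRoot-* (sum-ones≉0 m) ν-inverseRoot (√†-isInverseRoot (0≤s j)))

    weightD-x : ∀ κ i → weight D (xD κ i) ≈ √† (r i)
    weightD-x κ i = weight-≈ D (xD κ i) (0≤r i)
      (trans (rowSum-* D (xD κ i)) (trans (D-at-x B (λ _ → 1#) κ i) (sym (rowSum-* B i))))
      (√†-isInverseRoot (0≤r i))

    -- The factor `√† ν` comes from the weight of the x-coordinates in C and from that of the
    -- y-coordinate in D. At a vanishing `r i` or `s j` the entry is 0.
    G : Matrix p q
    G i j = √† ν * √† (r i) * B i j * √† (s j)

    scalesC : Scales (weight C⊕0) (weight C⊕0) C⊕0 (matrixC n G ⊕ zeros (m ℕ.* d) (m ℕ.* d))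
    scalesC = scales-block (weight C⊕0) (weight C⊕0)
      (scales-block (weight C⊕0 ∘ (_↑ˡ (m ℕ.* d))) (weight C⊕0 ∘ (_↑ˡ (m ℕ.* d)))
        (scales-zeros {p} {p} _ _)
        (scales-rowOfCopies n {A = B} {G} λ κ i j → *-cong (*-congʳ (weightC-x i)) (weightC-y κ j))
        (scales-columnOfCopies n λ κ j i → trans
          (*-cong (*-congʳ (weightC-y κ j)) (weightC-x i))
          (solve 3 (λ a b t → t :* b :* a := a :* b :* t) refl (√† ν * √† (r i)) (B i j) (√† (s j))))
        (scales-zeros {n ℕ.* q} {n ℕ.* q} _ _))
      -- Zero blocks stay zero under any weights, those of the padding coordinates included.
      (scales-zeros {p ℕ.+ n ℕ.* q} {m ℕ.* d} _ _)
      (scales-zeros {m ℕ.* d} {p ℕ.+ n ℕ.* q} _ _)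
      (scales-zeros {m ℕ.* d} {m ℕ.* d} _ _)

    scalesD : Scales (weight D) (weight D) D (matrixD n G)
    scalesD = scales-block (weight D) (weight D)
      (scales-zeros {q} {q} _ _)
      (scales-rowOfCopies n λ κ j i → trans
        (*-cong (*-congʳ (weightD-y j)) (weightD-x κ i))
        (solve 4 (λ a x b t → a :* t :* b :* x := a :* x :* b :* t) refl (√† ν) (√† (r i)) (B i j) (√† (s j))))
      (scales-columnOfCopies n λ κ i j → trans
        (*-cong (*-congʳ (weightD-x κ i)) (weightD-y j))
        (solve 4 (λ a x b t → x :* b :* (a :* t) := a :* x :* b :* t) refl (√† ν) (√† (r i)) (B i j) (√† (s j))))
      (scales-zeros {n ℕ.* p} {n ℕ.* p} _ _)

    laplacians-similar : Similar (normalizedLaplacian C⊕0) (normalizedLaplacian D)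
    laplacians-similar = similar-resp
      (normalizedLaplacian-entry C⊕0 _ scalesC) (normalizedLaplacian-entry D _ scalesD)
      (similar-⊖ 1# (similarity G))

    -- This count determines the amount of padding: n p + q exceeds n q + p by (n - 1)(p - q).
    size : (p ℕ.+ n ℕ.* q) ℕ.+ m ℕ.* d ≡ q ℕ.+ n ℕ.* p
    size = solveℕ 3 (λ m q d → ((q ⊞ d) ⊞ (q ⊞ m ⊠ q)) ⊞ m ⊠ d ⊜ q ⊞ ((q ⊞ d) ⊞ m ⊠ (q ⊞ d))) ≡.refl m q d
      where open +-*-Solver renaming (solve to solveℕ; _:+_ to _⊞_; _:*_ to _⊠_; _:=_ to _⊜_)

    laplacians-cospectral : Cospectral (normalizedLaplacian C⊕0) (normalizedLaplacian D)
    laplacians-cospectral = sameSpectrum-similar (complexRing commutativeRing) size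
      (similar-homo commutativeRing (complexRing commutativeRing) (real-homo commutativeRing) laplacians-similar)

open import Data.Nat.Base using (_∸_; _*_; _≤_)

theorem3p3 : ∀ {c ℓ₁ ℓ₂ : Level} (ℝ : CompleteOrderedField c ℓ₁ ℓ₂) →
    let open RealMatrices ℝ in
    (p q n : ℕ) → 1 ≤ q → q ≤ p → 1 ≤ n →
    (B : Matrix p q) → NonNegative B →
    Cospectral
    (normalizedLaplacian (matrixC n B ⊕ zeros ((n ∸ 1) * (p ∸ q)) ((n ∸ 1) * (p ∸ q))))
    (normalizedLaplacian (matrixD n B))
theorem3p3 ℝ p q (suc m) 1≤q q≤p 1≤n B 0≤B with ℕ.m≤n⇒∃[o]m+o≡n q≤p
-- With n = m + 1 and p = q + d, the term n ∸ 1 reduces to m, but q + d ∸ q equals d only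
-- propositionally; the substitution rewrites the padding size.
... | d , ≡.refl = ≡.subst
  (λ r → Cospectral (normalizedLaplacian (matrixC (suc m) B ⊕ zeros (m * r) (m * r)))
                    (normalizedLaplacian (matrixD (suc m) B)))
  (≡.sym (ℕ.m+n∸m≡n q d))
  (Laplacian.laplacians-cospectral ℝ m q d B 0≤B)
  where open RealMatrices ℝ
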